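{- Let $r_1,\ldots,r_s$ be positive integers and let $G$ be a connected nontraceable graph of order $n$, detour order $p$ and minimum degree $\delta(G)\ge k$. Then $$N(K_{r_1,\ldots,r_s},G)\le \max\{g_{r_1,\ldots,r_s}(n,p-1,k),\ g_{r_1,\ldots,r_s}(n,p-1,\lfloor (p-1)/2\rfloor)\}.$$
   Context: A graph is nontraceable if it has no Hamilton path. The detour order of a graph is the number of vertices of a longest path in it. For positive integers $r_1,\ldots,r_s$, $K_{r_1,\ldots,r_s}$ denotes the complete multipartite graph with $s$ parts of sizes $r_1,\ldots,r_s$. For graphs $H$ and $G$, $N(H,G)$ denotes the number of subgraphs of $G$ isomorphic to $H$. For integers $n,c,k$ with $k\ge 0$ and $n-1\ge c\ge 2k$, let $G(n,c,k)=K_k\vee\left(K_{c+1-2k}+\overline{K_{n-c-1+k}}\right)$, where $\vee$ denotes join (disjoint union plus all edges between the two graphs), $+$ denotes disjoint union, $K_m$ is the complete graph on $m$ vertices ($K_0$ empty), and $\overline{K_m}$ is the edgeless graph on $m$ vertices. Define $g_{r_1,\ldots,r_s}(n,c,k)=N(K_{r_1,\ldots,r_s},G(n,c,k))$. -}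

module Defs where

open import Data.Nat using (ℕ; zero; suc; _+_; _∸_; _≤_; _≡ᵇ_; _<ᵇ_)
open import Data.Bool using (Bool; true; false; not; _∧_; _∨_; if_then_else_)
open import Data.Fin using (Fin; toℕ; _≟_)
open import Data.Vec using (Vec; []; _∷_; lookup)
open import Data.List using (List; []; _∷_; length; map; concatMap; filterᵇ; allFin; cartesianProduct)
open import Data.Bool.ListAction using (all; any)
open import Data.Nat.ListAction using (sum)
open import Data.List.Relation.Unary.Unique.Propositional using (Unique)
open import Data.List.Relation.Unary.Linked using (Linked)
open import Data.List.Membership.Propositional using (_∈_)
open import Data.Product using (Σ; _×_; _,_; proj₁; proj₂; ∃)
open import Relation.Binary.PropositionalEquality using (_≡_; refl)
open import Relation.Nullary using (¬_)
open import Relation.Nullary.Decidable using (⌊_⌋)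

≡ᵇ-refl : ∀ m → (m ≡ᵇ m) ≡ true
≡ᵇ-refl zero = refl
≡ᵇ-refl (suc m) = ≡ᵇ-refl m

≡ᵇ-sym : ∀ m n → (m ≡ᵇ n) ≡ (n ≡ᵇ m)
≡ᵇ-sym zero zero = refl
≡ᵇ-sym zero (suc n) = refl
≡ᵇ-sym (suc m) zero = refl
≡ᵇ-sym (suc m) (suc n) = ≡ᵇ-sym m n

record Graph (n : ℕ) : Set where
  field
    adj    : Fin n → Fin n → Bool
    sym    : ∀ u v → adj u v ≡ adj v u
    irrefl : ∀ v → adj v v ≡ false

open Graph public

Adj : ∀ {n} → Graph n → Fin n → Fin n → Set
Adj G u v = adj G u v ≡ true

IsPath : ∀ {n} → Graph n → List (Fin n) → Set
IsPath G P = Unique P × Linked (Adj G) P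

IsHamiltonPath : ∀ {n} → Graph n → List (Fin n) → Set
IsHamiltonPath {n} G P = IsPath G P × (∀ (v : Fin n) → v ∈ P)

Nontraceable : ∀ {n} → Graph n → Set
Nontraceable G = ¬ (∃ λ P → IsHamiltonPath G P)

DetourOrder : ∀ {n} → Graph n → ℕ → Set
DetourOrder G p = (∃ λ P → IsPath G P × length P ≡ p)
                × (∀ P → IsPath G P → length P ≤ p)

data Walk {n} (G : Graph n) : Fin n → Fin n → Set where
  here : ∀ {u} → Walk G u u
  step : ∀ {u v w} → Adj G u v → Walk G v w → Walk G u w

Connected : ∀ {n} → Graph n → Set
Connected {n} G = ∀ (u v : Fin n) → Walk G u v

degree : ∀ {n} → Graph n → Fin n → ℕ
degree {n} G v = length (filterᵇ (adj G v) (allFin n))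

MinDegreeAtLeast : ∀ {n} → Graph n → ℕ → Set
MinDegreeAtLeast {n} G k = ∀ (v : Fin n) → k ≤ degree G v

vecsOver : ∀ {A : Set} (m : ℕ) → List A → List (Vec A m)
vecsOver zero xs = [] ∷ []
vecsOver (suc m) xs = concatMap (λ x → map (x ∷_) (vecsOver m xs)) xs

allBools : List Bool
allBools = true ∷ false ∷ []

_=ᶠ_ : ∀ {n} → Fin n → Fin n → Bool
i =ᶠ j = ⌊ i ≟ j ⌋

_⇒ᵇ_ : Bool → Bool → Bool
a ⇒ᵇ b = not a ∨ b

_⇔ᵇ_ : Bool → Bool → Bool
true ⇔ᵇ b = b
false ⇔ᵇ b = not b

-- A subgraph of G is a pair (S , F) of a vertex subset S and an edge
-- subset F (given as a symmetric Boolean matrix) with F ⊆ E(G) and every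
-- edge of F having both ends in S.
SubgraphData : ℕ → Set
SubgraphData n = Vec Bool n × Vec (Vec Bool n) n

isSubgraph : ∀ {n} → Graph n → SubgraphData n → Bool
isSubgraph {n} G (S , F) =
  all (λ i → all (λ j →
        (lookup (lookup F i) j ⇒ᵇ (adj G i j ∧ lookup S i ∧ lookup S j))
      ∧ (lookup (lookup F i) j ⇔ᵇ lookup (lookup F j) i)) (allFin n)) (allFin n)

isIsoTo : ∀ {m n} → Graph m → SubgraphData n → Bool
isIsoTo {m} {n} H (S , F) = any isIso (vecsOver m (allFin n))
  where
  isIso : Vec (Fin n) m → Bool
  isIso f =
      all (λ a → all (λ b → (lookup f a =ᶠ lookup f b) ⇒ᵇ (a =ᶠ b)) (allFin m)) (allFin m)
    ∧ all (λ i → lookup S i ⇔ᵇ any (λ a → lookup f a =ᶠ i) (allFin m)) (allFin n)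
    ∧ all (λ a → all (λ b → adj H a b ⇔ᵇ lookup (lookup F (lookup f a)) (lookup f b))
                      (allFin m)) (allFin m)

allSubgraphData : (n : ℕ) → List (SubgraphData n)
allSubgraphData n = cartesianProduct (vecsOver n allBools) (vecsOver n (vecsOver n allBools))

N : ∀ {m n} → Graph m → Graph n → ℕ
N H G = length (filterᵇ (λ X → isSubgraph G X ∧ isIsoTo H X) (allSubgraphData _))

-- Complete multipartite graph K_{r_1,...,r_s}, rs = r_1 ∷ ... ∷ r_s []
-- vertices 0..r_1-1 form part 0, the next r_2 form part 1, etc.

partOf : List ℕ → ℕ → ℕ
partOf [] i = 0
partOf (r ∷ rs) i = if i <ᵇ r then 0 else suc (partOf rs (i ∸ r))

K : (rs : List ℕ) → Graph (sum rs)
K rs = record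
  { adj = λ a b → not (partOf rs (toℕ a) ≡ᵇ partOf rs (toℕ b))
  ; sym = λ a b → symK a b
  ; irrefl = λ a → irr a
  }
  where
  open import Relation.Binary.PropositionalEquality using (cong)
  symK : ∀ a b → not (partOf rs (toℕ a) ≡ᵇ partOf rs (toℕ b))
                                    ≡ not (partOf rs (toℕ b) ≡ᵇ partOf rs (toℕ a))
  symK a b = cong not (≡ᵇ-sym (partOf rs (toℕ a)) (partOf rs (toℕ b)))
  irr : ∀ a → not (partOf rs (toℕ a) ≡ᵇ partOf rs (toℕ a)) ≡ false
  irr a = cong not (≡ᵇ-refl (partOf rs (toℕ a)))

-- G(n,c,k) = K_k ∨ (K_{c+1-2k} + complement of K_{n-c-1+k}) on Fin n:
-- vertices with index < k form K_k, indices k .. c-k form K_{c+1-2k},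
-- the remaining n-c-1+k vertices are independent (when n-1 ≥ c ≥ 2k).

orLemma : ∀ a b x y → (a ∨ (b ∨ (x ∧ y))) ≡ (b ∨ (a ∨ (y ∧ x)))
orLemma true true x y = refl
orLemma true false true true = refl
orLemma true false true false = refl
orLemma true false false true = refl
orLemma true false false false = refl
orLemma false true x y = refl
orLemma false false true true = refl
orLemma false false true false = refl
orLemma false false false true = refl
orLemma false false false false = refl

Gnck : (n c k : ℕ) → Graph n
Gnck n c k = record
  { adj = A
  ; sym = symA
  ; irrefl = λ i → cong (λ z → not z ∧ rest i i) (≡ᵇ-refl (toℕ i))
  }
  where
  open import Relation.Binary.PropositionalEquality using (cong; cong₂)
  rest : Fin n → Fin n → Bool
  rest i j = (toℕ i <ᵇ k) ∨ ((toℕ j <ᵇ k) ∨ ((toℕ i <ᵇ (c + 1 ∸ k)) ∧ (toℕ j <ᵇ (c + 1 ∸ k))))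
  A : Fin n → Fin n → Bool
  A i j = not (toℕ i ≡ᵇ toℕ j) ∧ rest i j
  symA : ∀ i j → A i j ≡ A j i
  symA i j = cong₂ (λ u v → not u ∧ v) (≡ᵇ-sym (toℕ i) (toℕ j))
               (orLemma (toℕ i <ᵇ k) (toℕ j <ᵇ k) (toℕ i <ᵇ (c + 1 ∸ k)) (toℕ j <ᵇ (c + 1 ∸ k)))

g : (rs : List ℕ) → (n c k : ℕ) → ℕ
g rs n c k = N (K rs) (Gnck n c k)

{-# OPTIONS --safe #-}

-- Add edges to G as long as no path on more than p vertices appears. In the resulting graph Kopylov's
-- argument applies: two non-adjacent vertices end two disjoint paths with more than p vertices in total, and
-- Pósa's crossing argument on such a pair shows that vertices in a set of inner degree ≥ a and a set of inner
-- degree ≥ b are adjacent whenever a + b ≥ p. Hence for some k ≤ q ≤ (p - 1) / 2 the graph can be ordered so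
-- that every vertex from position p - q on has at most q earlier neighbours.
--
-- All counting is done by permuting vertices of copies, using only that non-adjacency is transitive in a
-- complete multipartite graph: every edge of a copy meets the neighbourhood of each vertex of the copy. A copy
-- in the ordered graph whose last vertex is z is moved into G(n, p - 1, q) by compressing the earlier neighbours
-- of z into the first q vertices. Transpositions show that the number of copies gained in passing from q to
-- q + 1 increases with q and the number lost decreases, so the count is convex in q and is largest at an end.

module Submission where

open import Defs renaming (sym to adj-sym)
open import Data.Nat using (ℕ; _≤_; _∸_; _⊔_; _/_)
open import Data.List using (List)
open import Data.List.Relation.Unary.All using (All)
open import Data.Bool using (Bool; true; false; not; _∧_; _∨_; T; T?)
open import Data.Bool.ListAction using (all; any)
import Data.Bool as Bool
open import Data.Bool.Properties using (T-≡; ∨-comm; ∧-comm; ∨-zeroʳ)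
open import Data.Empty using (⊥)
open import Data.Fin using (Fin; zero; suc; toℕ; fromℕ<; inject≤; _≟_)
open import Data.Fin.Permutation using (Permutation′; _⟨$⟩ʳ_; _⟨$⟩ˡ_; inverseˡ; inverseʳ; transpose; flip; _∘ₚ_) renaming (id to idₚ)
open import Data.Fin.Properties using (any?; toℕ-fromℕ<; toℕ-injective; toℕ<n; toℕ-inject≤; inject≤-injective)
open import Data.List using ([]; _∷_; _++_; length; map; concatMap; filterᵇ; allFin; reverse; cartesianProduct; cartesianProductWith)
open import Data.List.Membership.Propositional using (_∈_; _∉_)
import Data.List.Membership.DecPropositional as DecMembership
open import Data.List.Membership.Propositional.Properties
  using (∈-map⁺; ∈-map⁻; ∈-∃++; ∈-++⁺ˡ; ∈-++⁺ʳ; ∈-++⁻; ∈-filter⁺; ∈-filter⁻; ∈-allFin; ∈-cartesianProduct⁺; ∈-cartesianProductWith⁺)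
open import Data.List.Properties
  using (length-map; length-++; length-reverse; length-tabulate; filter-++; filter-all; unfold-reverse; ++-assoc; ++-identityʳ)
open import Data.List.Relation.Unary.All as All using ([]; _∷_)
import Data.List.Relation.Unary.All.Properties as All
open import Data.List.Relation.Unary.AllPairs using (AllPairs; []; _∷_)
open import Data.List.Relation.Unary.Any using (here; there)
open import Data.List.Relation.Unary.Any.Properties using (reverse⁺; reverse⁻)
open import Data.List.Relation.Unary.Linked using (Linked; []; [-]; _∷_)
open import Data.List.Relation.Unary.Unique.Propositional using (Unique)
open import Data.List.Relation.Unary.Unique.Propositional.Properties
  using () renaming (++⁺ to Unique-++⁺; map⁺ to Unique-map⁺; map⁻ to Unique-map⁻; filter⁺ to Unique-filter⁺; allFin⁺ to Unique-allFin;
                     cartesianProduct⁺ to Unique-cartesianProduct; cartesianProductWith⁺ to Unique-cartesianProductWith)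
open import Data.Maybe using (Maybe; just; nothing)
open import Data.Maybe.Properties using (just-injective) renaming (≡-dec to Maybe-≡-dec)
open import Data.Nat hiding (_≟_)
open import Data.Nat.DivMod using (m/n*n≤m; m≡m%n+[m/n]*n; m%n<n)
open import Data.Nat.Properties hiding (_≟_)
open import Data.Nat.Solver using (module +-*-Solver)
open import Data.Product using (Σ; _×_; _,_; proj₁; proj₂; ∃; ∃₂)
open import Data.Sum using (_⊎_; inj₁; inj₂; [_,_]′)
open import Data.Vec using (Vec; []; _∷_; lookup; tabulate)
open import Data.Vec.Properties using (lookup∘tabulate; ∷-injective; tabulate∘lookup; tabulate-cong)
open import Function using (_∘_; id)
open import Function.Bundles using (Equivalence)
open import Relation.Binary.PropositionalEquality
open import Relation.Nullary using (¬_; ¬?; Dec; yes; no; contradiction)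
open import Relation.Nullary.Decidable using (_×-dec_; decidable-stable)

-- Pósa's argument produces cycles, whereas the bound on G concerns paths. A universal vertex
-- reconciles the two: disjoint paths with more than p vertices in total become one path on at least
-- p + 2 vertices, and a cycle on at least p + 2 vertices leaves a path on more than p once that
-- vertex is deleted. When there is no crossing, the universal vertex itself confines the neighbours
-- of either end to the path starting at that end, and connectedness has to link the two paths.
--
-- The number q comes from a clique. Unless q = (p - 1) / 2 works, a maximal clique R on r > p - (p
-- - 1) / 2 vertices appears, and q is p - r. As R has inner degree r - 1, a set of inner degree at
-- least q + 1 is completely joined to R and so, by maximality, contained in R. Since R has only p -
-- q vertices, removing vertices of degree at most q cannot get stuck while more than p - q vertices
-- remain.
--
-- Different copies are moved by different permutations, which endangers injectivity. The
-- permutation therefore depends only on the last vertex of the copy and keeps it last, so that it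
-- can be read off from the image.

private variable
  A B : Set

-- Booleans and lists without repetition

∧-elim : ∀ {a b} → a ∧ b ≡ true → a ≡ true × b ≡ true
∧-elim {true} e = refl , e

∧-intro : ∀ {a b} → a ≡ true → b ≡ true → a ∧ b ≡ true
∧-intro refl e = e

not-elim : ∀ {a} → not a ≡ true → a ≡ false
not-elim {false} _ = refl

not-intro : ∀ {a} → a ≡ false → not a ≡ true
not-intro refl = refl

true≢false : ∀ {a} → a ≡ true → a ≡ false → ∀ {ℓ} {C : Set ℓ} → C
true≢false refl ()

≢true⇒false : ∀ {a} → ¬ (a ≡ true) → a ≡ false
≢true⇒false {true} h = contradiction refl h
≢true⇒false {false} _ = refl

T⇒≡ : ∀ {a} → T a → a ≡ true
T⇒≡ = Equivalence.to T-≡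

≡⇒T : ∀ {a} → a ≡ true → T a
≡⇒T = Equivalence.from T-≡

<ᵇ-elim : ∀ {m n} → (m <ᵇ n) ≡ true → m < n
<ᵇ-elim = <ᵇ⇒< _ _ ∘ ≡⇒T

<ᵇ-intro : ∀ {m n} → m < n → (m <ᵇ n) ≡ true
<ᵇ-intro = T⇒≡ ∘ <⇒<ᵇ

∈-filterᵇ⁺ : ∀ (p : A → Bool) {x xs} → x ∈ xs → p x ≡ true → x ∈ filterᵇ p xs
∈-filterᵇ⁺ p x∈ e = ∈-filter⁺ (T? ∘ p) x∈ (≡⇒T e)

∈-filterᵇ⁻ : ∀ (p : A → Bool) xs {x} → x ∈ filterᵇ p xs → x ∈ xs × p x ≡ true
∈-filterᵇ⁻ p xs x∈ with ∈-filter⁻ (T? ∘ p) {xs = xs} x∈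
... | x∈xs , t = x∈xs , T⇒≡ t

∉⇒All≢ : ∀ {x : A} {xs} → x ∉ xs → All (x ≢_) xs
∉⇒All≢ {xs = xs} x∉ = All.tabulate λ y∈ e → x∉ (subst (_∈ xs) (sym e) y∈)

Unique-head : ∀ {x : A} {xs} → Unique (x ∷ xs) → x ∉ xs
Unique-head (h ∷ _) x∈ = All.lookup h x∈ refl

Unique-length-≤ : {xs ys : List A} → Unique xs → (∀ {x} → x ∈ xs → x ∈ ys) → length xs ≤ length ys
Unique-length-≤ [] _ = z≤n
Unique-length-≤ {xs = x ∷ xs} u@(_ ∷ uxs) sub with ∈-∃++ (sub (here refl))
... | l , r , refl = begin
    suc (length xs)             ≤⟨ s≤s (Unique-length-≤ uxs sub′) ⟩
    suc (length (l ++ r))       ≡⟨ cong suc (length-++ l) ⟩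
    suc (length l + length r)   ≡⟨ +-suc (length l) (length r) ⟨
    length l + suc (length r)   ≡⟨ length-++ l ⟨
    length (l ++ x ∷ r)         ∎
  where
  open ≤-Reasoning
  sub′ : ∀ {y} → y ∈ xs → y ∈ l ++ r
  sub′ y∈ with ∈-++⁻ l (sub (there y∈))
  ... | inj₁ y∈l = ∈-++⁺ˡ y∈l
  ... | inj₂ (here refl) = contradiction y∈ (Unique-head u)
  ... | inj₂ (there y∈r) = ∈-++⁺ʳ l y∈r

-- Counting

count : List A → (A → Bool) → ℕ
count xs p = length (filterᵇ p xs)

count-++ : (p : A → Bool) (xs ys : List A) → count (xs ++ ys) p ≡ count xs p + count ys p
count-++ p xs ys = trans (cong length (filter-++ (T? ∘ p) xs ys)) (length-++ (filterᵇ p xs))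

count-∷-true : (p : A → Bool) {x : A} (xs : List A) → p x ≡ true → count (x ∷ xs) p ≡ suc (count xs p)
count-∷-true p {x} xs e with p x
count-∷-true p {x} xs refl | true = refl

count-∷-false : (p : A → Bool) {x : A} (xs : List A) → p x ≡ false → count (x ∷ xs) p ≡ count xs p
count-∷-false p {x} xs e with p x
count-∷-false p {x} xs refl | false = refl

count-split : (xs : List A) (p q : A → Bool) →
              count xs p ≡ count xs (λ x → p x ∧ q x) + count xs (λ x → p x ∧ not (q x))
count-split [] p q = refl
count-split (x ∷ xs) p q with p x | q x
... | false | _     = count-split xs p q
... | true  | true  = cong suc (count-split xs p q)
... | true  | false = trans (cong suc (count-split xs p q)) (sym (+-suc _ _))

Unique-map-on : (f : A → B) {xs : List A} → Unique xs →
                (∀ {x y} → x ∈ xs → y ∈ xs → f x ≡ f y → x ≡ y) → Unique (map f xs)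
Unique-map-on f [] inj = []
Unique-map-on f {x ∷ xs} (h ∷ u) inj =
  All.map⁺ (All.tabulate λ y∈ e → All.lookup h y∈ (inj (here refl) (there y∈) e))
  ∷ Unique-map-on f u (λ a b → inj (there a) (there b))

count-injection : {xs : List A} {ys : List B} → Unique xs → (∀ y → y ∈ ys) →
                  {p : A → Bool} {q : B → Bool} (f : A → B) →
                  (∀ {x y} → p x ≡ true → p y ≡ true → f x ≡ f y → x ≡ y) →
                  (∀ {x} → p x ≡ true → q (f x) ≡ true) →
                  count xs p ≤ count ys q
count-injection {xs = xs} {ys} u all∈ {p} {q} f inj imp = begin
    length (filterᵇ p xs)          ≡⟨ length-map f (filterᵇ p xs) ⟨
    length (map f (filterᵇ p xs))  ≤⟨ Unique-length-≤ uniq sub ⟩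
    length (filterᵇ q ys)          ∎
  where
  open ≤-Reasoning
  uniq : Unique (map f (filterᵇ p xs))
  uniq = Unique-map-on f (Unique-filter⁺ (T? ∘ p) u)
           (λ a b → inj (proj₂ (∈-filterᵇ⁻ p xs a)) (proj₂ (∈-filterᵇ⁻ p xs b)))
  sub : ∀ {y} → y ∈ map f (filterᵇ p xs) → y ∈ filterᵇ q ys
  sub y∈ with ∈-map⁻ f y∈
  ... | x , x∈ , refl = ∈-filterᵇ⁺ q (all∈ _) (imp (proj₂ (∈-filterᵇ⁻ p xs x∈)))

countᶠ : ∀ {n} → (Fin n → Bool) → ℕ
countᶠ {n} p = count (allFin n) p

countᶠ-injection : ∀ {m n} {p : Fin m → Bool} {q : Fin n → Bool} (f : Fin m → Fin n) →
                   (∀ {x y} → p x ≡ true → p y ≡ true → f x ≡ f y → x ≡ y) →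
                   (∀ {x} → p x ≡ true → q (f x) ≡ true) → countᶠ p ≤ countᶠ q
countᶠ-injection {m} = count-injection (Unique-allFin m) ∈-allFin

countᶠ-mono : ∀ {n} {p q : Fin n → Bool} → (∀ {x} → p x ≡ true → q x ≡ true) → countᶠ p ≤ countᶠ q
countᶠ-mono = countᶠ-injection id (λ _ _ e → e)

countᶠ-≤-list : ∀ {n} {p : Fin n → Bool} {xs} → (∀ {x} → p x ≡ true → x ∈ xs) → countᶠ p ≤ count xs p
countᶠ-≤-list {n} {p} cover =
  Unique-length-≤ (Unique-filter⁺ (T? ∘ p) (Unique-allFin n))
    (λ x∈ → let e = proj₂ (∈-filterᵇ⁻ p (allFin n) x∈) in ∈-filterᵇ⁺ p (cover e) e)

count-≤-length : (p : A → Bool) (xs : List A) → count xs p ≤ length xs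
count-≤-length p [] = z≤n
count-≤-length p (x ∷ xs) with p x
... | true  = s≤s (count-≤-length p xs)
... | false = m≤n⇒m≤1+n (count-≤-length p xs)

count-mono : {p q : A → Bool} → (∀ {x} → p x ≡ true → q x ≡ true) → ∀ xs → count xs p ≤ count xs q
count-mono imp [] = z≤n
count-mono {p = p} {q} imp (x ∷ xs) with p x | q x | imp {x}
... | true  | true  | _ = s≤s (count-mono imp xs)
... | true  | false | h = contradiction (h refl) λ ()
... | false | true  | _ = m≤n⇒m≤1+n (count-mono imp xs)
... | false | false | _ = count-mono imp xs

count-none : (p : A → Bool) {xs : List A} → All (λ x → p x ≡ false) xs → count xs p ≡ 0
count-none p [] = refl
count-none p {x ∷ xs} (h ∷ hs) = trans (count-∷-false p xs h) (count-none p hs)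

count-map : (f : A → B) (p : B → Bool) (xs : List A) → count (map f xs) p ≡ count xs (p ∘ f)
count-map f p [] = refl
count-map f p (x ∷ xs) with p (f x)
... | true  = cong suc (count-map f p xs)
... | false = count-map f p xs

count-reverse : (p : A → Bool) (xs : List A) → count (reverse xs) p ≡ count xs p
count-reverse p [] = refl
count-reverse p (x ∷ xs) = begin
    count (reverse (x ∷ xs)) p                ≡⟨ cong (λ ys → count ys p) (unfold-reverse x xs) ⟩
    count (reverse xs ++ x ∷ []) p            ≡⟨ count-++ p (reverse xs) (x ∷ []) ⟩
    count (reverse xs) p + count (x ∷ []) p   ≡⟨ cong (_+ count (x ∷ []) p) (count-reverse p xs) ⟩
    count xs p + count (x ∷ []) p             ≡⟨ +-comm (count xs p) _ ⟩
    count (x ∷ []) p + count xs p             ≡⟨ count-++ p (x ∷ []) xs ⟨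
    count (x ∷ xs) p                          ∎
  where open ≡-Reasoning

-- Copies of a graph

all-elim : (p : A → Bool) {xs : List A} → all p xs ≡ true → ∀ {x} → x ∈ xs → p x ≡ true
all-elim p {x ∷ xs} e (here refl) = proj₁ (∧-elim e)
all-elim p {x ∷ xs} e (there x∈) = all-elim p (proj₂ (∧-elim {p x} e)) x∈

all-intro : (p : A → Bool) (xs : List A) → (∀ x → p x ≡ true) → all p xs ≡ true
all-intro p [] h = refl
all-intro p (x ∷ xs) h = ∧-intro (h x) (all-intro p xs h)

any-elim : (p : A → Bool) (xs : List A) → any p xs ≡ true → ∃ λ x → p x ≡ true
any-elim p (x ∷ xs) e with p x in eq
... | true  = x , eq
... | false = any-elim p xs e

any-intro : (p : A → Bool) {xs : List A} {x : A} → x ∈ xs → p x ≡ true → any p xs ≡ true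
any-intro p {x ∷ xs} (here refl) e rewrite e = refl
any-intro p {y ∷ xs} (there x∈) e with p y
... | true  = refl
... | false = any-intro p x∈ e

allᶠ-elim : ∀ {n} (p : Fin n → Bool) → all p (allFin n) ≡ true → ∀ i → p i ≡ true
allᶠ-elim p e i = all-elim p e (∈-allFin i)

⇒ᵇ-elim : ∀ {a b} → (a ⇒ᵇ b) ≡ true → a ≡ true → b ≡ true
⇒ᵇ-elim e refl = e

⇒ᵇ-intro : ∀ a {b} → (a ≡ true → b ≡ true) → (a ⇒ᵇ b) ≡ true
⇒ᵇ-intro true  h = h refl
⇒ᵇ-intro false h = refl

⇔ᵇ-elim : ∀ a b → (a ⇔ᵇ b) ≡ true → a ≡ b
⇔ᵇ-elim true  true  e = refl
⇔ᵇ-elim false false e = refl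

⇔ᵇ-intro : ∀ {a b} → a ≡ b → (a ⇔ᵇ b) ≡ true
⇔ᵇ-intro {true}  refl = refl
⇔ᵇ-intro {false} refl = refl

bool-ext : ∀ {a b} → (a ≡ true → b ≡ true) → (b ≡ true → a ≡ true) → a ≡ b
bool-ext {true}          f g = sym (f refl)
bool-ext {false} {true}  f g = g refl
bool-ext {false} {false} f g = refl

=ᶠ-elim : ∀ {n} {i j : Fin n} → (i =ᶠ j) ≡ true → i ≡ j
=ᶠ-elim {i = i} {j} e with i ≟ j
... | yes i≡j = i≡j

=ᶠ-intro : ∀ {n} {i j : Fin n} → i ≡ j → (i =ᶠ j) ≡ true
=ᶠ-intro {i = i} refl with i ≟ i
... | yes _ = refl
... | no ≢  = contradiction refl ≢

-- Cartesian products are known to be complete and free of repetitions, and the enumeration inherits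
-- both.
vecsOver-suc : ∀ m (xs : List A) → vecsOver (suc m) xs ≡ cartesianProductWith _∷_ xs (vecsOver m xs)
vecsOver-suc m xs = go xs
  where
  go : ∀ ys → concatMap (λ x → map (x ∷_) (vecsOver m xs)) ys ≡ cartesianProductWith _∷_ ys (vecsOver m xs)
  go [] = refl
  go (y ∷ ys) = cong (map (y ∷_) (vecsOver m xs) ++_) (go ys)

∈-vecsOver : ∀ m {xs : List A} → (∀ x → x ∈ xs) → (v : Vec A m) → v ∈ vecsOver m xs
∈-vecsOver zero all∈ [] = here refl
∈-vecsOver (suc m) {xs} all∈ (x ∷ v) rewrite vecsOver-suc m xs =
  ∈-cartesianProductWith⁺ _∷_ (all∈ x) (∈-vecsOver m all∈ v)

Unique-vecsOver : ∀ m {xs : List A} → Unique xs → Unique (vecsOver m xs)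
Unique-vecsOver zero u = [] ∷ []
Unique-vecsOver (suc m) {xs} u rewrite vecsOver-suc m xs =
  Unique-cartesianProductWith _∷_ ∷-injective u (Unique-vecsOver m u)

∈-allBools : ∀ b → b ∈ allBools
∈-allBools true  = here refl
∈-allBools false = there (here refl)

Unique-allBools : Unique allBools
Unique-allBools = ((λ ()) ∷ []) ∷ [] ∷ []

∈-allSubgraphData : ∀ {n} (X : SubgraphData n) → X ∈ allSubgraphData n
∈-allSubgraphData {n} (S , F) =
  ∈-cartesianProduct⁺ (∈-vecsOver n ∈-allBools S) (∈-vecsOver n (∈-vecsOver n ∈-allBools) F)

Unique-allSubgraphData : ∀ n → Unique (allSubgraphData n)
Unique-allSubgraphData n = Unique-cartesianProduct (Unique-vecsOver n Unique-allBools)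
  (Unique-vecsOver n (Unique-vecsOver n Unique-allBools))

inS : ∀ {n} → SubgraphData n → Fin n → Bool
inS X i = lookup (proj₁ X) i

inF : ∀ {n} → SubgraphData n → Fin n → Fin n → Bool
inF X i j = lookup (lookup (proj₂ X) i) j

SubgraphData-ext : ∀ {n} {X Y : SubgraphData n} → (∀ i → inS X i ≡ inS Y i) →
                   (∀ i j → inF X i j ≡ inF Y i j) → X ≡ Y
SubgraphData-ext hS hF = cong₂ _,_ (ext hS) (ext λ i → ext (hF i))
  where
  ext : ∀ {B : Set} {n} {u v : Vec B n} → (∀ i → lookup u i ≡ lookup v i) → u ≡ v
  ext {u = u} {v} h = trans (sym (tabulate∘lookup u)) (trans (tabulate-cong h) (tabulate∘lookup v))

-- The propositional content of `isCopy`. Only one end of an edge is required to lie in the vertex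
-- set; `edge-sym` supplies the other.
record Copy {m n} (H : Graph m) (G : Graph n) (X : SubgraphData n) : Set where
  field
    edge⇒adj : ∀ {i j} → inF X i j ≡ true → adj G i j ≡ true
    edge⇒inS : ∀ {i j} → inF X i j ≡ true → inS X i ≡ true
    edge-sym : ∀ i j → inF X i j ≡ inF X j i
    embed    : Fin m → Fin n
    embed-inj : ∀ a b → embed a ≡ embed b → a ≡ b
    embed-inS : ∀ a → inS X (embed a) ≡ true
    embed-onto : ∀ {i} → inS X i ≡ true → ∃ λ a → embed a ≡ i
    embed-adj : ∀ a b → adj H a b ≡ inF X (embed a) (embed b)

isCopy : ∀ {m n} → Graph m → Graph n → SubgraphData n → Bool
isCopy H G X = isSubgraph G X ∧ isIsoTo H X

isCopy⇒Copy : ∀ {m n} {H : Graph m} {G : Graph n} X → isCopy H G X ≡ true → Copy H G X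
isCopy⇒Copy {m} {n} {H} {G} X e with ∧-elim {isSubgraph G X} e
... | sub , iso with any-elim _ (vecsOver m (allFin n)) iso
... | f , isof with ∧-elim isof
... | finj , isof′ with ∧-elim isof′
... | fS , fF = record
  { edge⇒adj = λ {i} {j} h → proj₁ (∧-elim (⇒ᵇ-elim (proj₁ (at i j)) h))
  ; edge⇒inS = λ {i} {j} h → proj₁ (∧-elim (proj₂ (∧-elim {adj G i j} (⇒ᵇ-elim (proj₁ (at i j)) h))))
  ; edge-sym = λ i j → ⇔ᵇ-elim _ _ (proj₂ (at i j))
  ; embed = lookup f
  ; embed-inj = λ a b eq → =ᶠ-elim (⇒ᵇ-elim (allᶠ-elim _ (allᶠ-elim _ finj a) b) (=ᶠ-intro eq))
  ; embed-inS = λ a → trans (⇔ᵇ-elim _ _ (allᶠ-elim _ fS (lookup f a))) (any-intro _ (∈-allFin a) (=ᶠ-intro refl))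
  ; embed-onto = λ {i} h → let a , eq = any-elim _ (allFin m) (trans (sym (⇔ᵇ-elim _ _ (allᶠ-elim _ fS i))) h)
                           in a , =ᶠ-elim eq
  ; embed-adj = λ a b → ⇔ᵇ-elim _ _ (allᶠ-elim _ (allᶠ-elim _ fF a) b)
  }
  where
  at : ∀ i j → _
  at i j = ∧-elim {inF X i j ⇒ᵇ (adj G i j ∧ inS X i ∧ inS X j)} {inF X i j ⇔ᵇ inF X j i}
             (allᶠ-elim _ (allᶠ-elim _ sub i) j)

Copy⇒isCopy : ∀ {m n} {H : Graph m} {G : Graph n} {X} → Copy H G X → isCopy H G X ≡ true
Copy⇒isCopy {m} {n} {H} {G} {X} C = ∧-intro
  (all-intro _ (allFin n) λ i → all-intro _ (allFin n) λ j → ∧-intro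
    (⇒ᵇ-intro _ λ h → ∧-intro (edge⇒adj h)
      (∧-intro (edge⇒inS h) (edge⇒inS (trans (edge-sym j i) h))))
    (⇔ᵇ-intro (edge-sym i j)))
  (any-intro _ (∈-vecsOver m ∈-allFin (tabulate embed)) (∧-intro
    (all-intro _ (allFin m) λ a → all-intro _ (allFin m) λ b → ⇒ᵇ-intro _ λ h →
      =ᶠ-intro (embed-inj a b (trans (sym (f≗ a)) (trans (=ᶠ-elim h) (f≗ b)))))
    (∧-intro
      (all-intro _ (allFin n) λ i → ⇔ᵇ-intro (bool-ext
        (λ h → let a , eq = embed-onto h in any-intro _ (∈-allFin a) (=ᶠ-intro (trans (f≗ a) eq)))
        (λ h → let a , eq = any-elim _ (allFin m) h
               in subst (λ i → inS X i ≡ true) (trans (sym (f≗ a)) (=ᶠ-elim eq)) (embed-inS a))))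
      (all-intro _ (allFin m) λ a → all-intro _ (allFin m) λ b → ⇔ᵇ-intro
        (trans (embed-adj a b) (sym (cong₂ (inF X) (f≗ a) (f≗ b))))))))
  where
  open Copy C
  f≗ : ∀ a → lookup (tabulate embed) a ≡ embed a
  f≗ = lookup∘tabulate embed

-- A pull-back: the vertex `π ⟨$⟩ʳ i` of the old copy sits at `i` in the new one, so vertices move
-- along the inverse of `π`.
permute : ∀ {n} → Permutation′ n → SubgraphData n → SubgraphData n
permute π X = tabulate (λ i → inS X (π ⟨$⟩ʳ i)) , tabulate λ i → tabulate λ j → inF X (π ⟨$⟩ʳ i) (π ⟨$⟩ʳ j)

module _ {n} (π : Permutation′ n) (X : SubgraphData n) where

  inS-permute : ∀ i → inS (permute π X) i ≡ inS X (π ⟨$⟩ʳ i)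
  inS-permute = lookup∘tabulate _

  inF-permute : ∀ i j → inF (permute π X) i j ≡ inF X (π ⟨$⟩ʳ i) (π ⟨$⟩ʳ j)
  inF-permute i j = trans (cong (λ r → lookup r j) (lookup∘tabulate _ i)) (lookup∘tabulate _ j)

permute-injective : ∀ {n} (π : Permutation′ n) {X Y} → permute π X ≡ permute π Y → X ≡ Y
permute-injective π {X} {Y} e = SubgraphData-ext
  (λ i → subst (λ i → inS X i ≡ inS Y i) (inverseʳ π) (eqS (π ⟨$⟩ˡ i)))
  (λ i j → subst₂ (λ i j → inF X i j ≡ inF Y i j) (inverseʳ π) (inverseʳ π) (eqF (π ⟨$⟩ˡ i) (π ⟨$⟩ˡ j)))
  where
  eqS : ∀ i → inS X (π ⟨$⟩ʳ i) ≡ inS Y (π ⟨$⟩ʳ i)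
  eqS i = trans (sym (inS-permute π X i)) (trans (cong (λ Z → inS Z i) e) (inS-permute π Y i))
  eqF : ∀ i j → inF X (π ⟨$⟩ʳ i) (π ⟨$⟩ʳ j) ≡ inF Y (π ⟨$⟩ʳ i) (π ⟨$⟩ʳ j)
  eqF i j = trans (sym (inF-permute π X i j)) (trans (cong (λ Z → inF Z i j) e) (inF-permute π Y i j))

-- Only edges used by the copy have to land in `G′`. The transpositions and compressions applied
-- later need not map all of `G` into `G′`.
Copy-permute : ∀ {m n} {H : Graph m} {G G′ : Graph n} (π : Permutation′ n) {X} → Copy H G X →
               (∀ i j → inF X (π ⟨$⟩ʳ i) (π ⟨$⟩ʳ j) ≡ true → adj G′ i j ≡ true) → Copy H G′ (permute π X)
Copy-permute π {X} C imp = record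
  { edge⇒adj = λ h → imp _ _ (trans (sym (inF-permute π X _ _)) h)
  ; edge⇒inS = λ h → trans (inS-permute π X _) (edge⇒inS (trans (sym (inF-permute π X _ _)) h))
  ; edge-sym = λ i j → trans (inF-permute π X i j) (trans (edge-sym _ _) (sym (inF-permute π X j i)))
  ; embed = λ a → π ⟨$⟩ˡ embed a
  ; embed-inj = λ a b e → embed-inj a b (trans (sym (inverseʳ π)) (trans (cong (π ⟨$⟩ʳ_) e) (inverseʳ π)))
  ; embed-inS = λ a → trans (inS-permute π X _) (trans (cong (inS X) (inverseʳ π)) (embed-inS a))
  ; embed-onto = λ h → let a , e = embed-onto (trans (sym (inS-permute π X _)) h)
                       in a , trans (cong (π ⟨$⟩ˡ_) e) (inverseˡ π)
  ; embed-adj = λ a b → trans (embed-adj a b)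
      (trans (sym (cong₂ (inF X) (inverseʳ π) (inverseʳ π))) (sym (inF-permute π X _ _)))
  }
  where open Copy C

Copy-mono : ∀ {m n} {H : Graph m} {G G′ : Graph n} {X} → Copy H G X →
            (∀ {i j} → inF X i j ≡ true → adj G′ i j ≡ true) → Copy H G′ X
Copy-mono C imp = record { edge⇒adj = imp ; Copy C }

countˢ : ∀ {n} → (SubgraphData n → Bool) → ℕ
countˢ {n} p = count (allSubgraphData n) p

countˢ-injection : ∀ {n} {p q : SubgraphData n → Bool} (f : SubgraphData n → SubgraphData n) →
                   (∀ {X Y} → p X ≡ true → p Y ≡ true → f X ≡ f Y → X ≡ Y) →
                   (∀ {X} → p X ≡ true → q (f X) ≡ true) → countˢ p ≤ countˢ q
countˢ-injection {n} = count-injection (Unique-allSubgraphData n) ∈-allSubgraphData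

N-mono : ∀ {m n} (H : Graph m) {G G′ : Graph n} → (∀ {i j} → adj G i j ≡ true → adj G′ i j ≡ true) → N H G ≤ N H G′
N-mono H {G} {G′} imp = countˢ-injection id (λ _ _ e → e) λ {X} h →
  let C = isCopy⇒Copy {H = H} {G} X h in Copy⇒isCopy {H = H} {G′} (Copy-mono C (imp ∘ Copy.edge⇒adj C))

-- Transitivity of non-adjacency in contrapositive form. It holds in a complete multipartite graph
-- because lying in the same part is an equivalence relation.
CoTransitive : ∀ {m} → Graph m → Set
CoTransitive H = ∀ a b c → adj H a c ≡ true → adj H a b ≡ true ⊎ adj H b c ≡ true

-- Read with `v` fixed, the neighbours of `v` cover all edges of the copy. Read with the edge fixed,
-- every vertex of the copy is adjacent to one of its ends. Both readings are used.
copy-cotransitive : ∀ {m n} {H : Graph m} {G : Graph n} {X} → CoTransitive H → Copy H G X →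
                    ∀ {u v w} → inS X v ≡ true → inF X u w ≡ true → inF X u v ≡ true ⊎ inF X v w ≡ true
copy-cotransitive {X = X} cot C {u} {v} {w} v∈ uw
  with embed-onto (edge⇒inS uw) | embed-onto v∈ | embed-onto (edge⇒inS (trans (edge-sym w u) uw))
  where open Copy C
... | a , refl | b , refl | c , refl with cot a b c (trans (embed-adj a c) uw)
  where open Copy C
... | inj₁ h = inj₁ (trans (sym (Copy.embed-adj C a b)) h)
... | inj₂ h = inj₂ (trans (sym (Copy.embed-adj C b c)) h)

K-cotransitive : ∀ rs → CoTransitive (K rs)
K-cotransitive rs a b c h with partOf rs (toℕ a) Data.Nat.≟ partOf rs (toℕ b)
... | yes e = inj₂ (subst (λ r → not (r ≡ᵇ partOf rs (toℕ c)) ≡ true) e h)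
... | no ≢ = inj₁ (not-intro (≢true⇒false λ t → ≢ (≡ᵇ⇒≡ _ _ (≡⇒T t))))

-- Transpositions

transpose-left : ∀ {n} (i j : Fin n) → transpose i j ⟨$⟩ʳ i ≡ j
transpose-left i j with i ≟ i
... | yes _ = refl
... | no ≢ = contradiction refl ≢

transpose-right : ∀ {n} (i j : Fin n) → transpose i j ⟨$⟩ʳ j ≡ i
transpose-right i j with j ≟ i
... | yes e = e
... | no _ with j ≟ j
... | yes _ = refl
... | no ≢ = contradiction refl ≢

transpose-other : ∀ {n} {i j k : Fin n} → k ≢ i → k ≢ j → transpose i j ⟨$⟩ʳ k ≡ k
transpose-other {i = i} {j} {k} ≢i ≢j with k ≟ i
... | yes e = contradiction e ≢i
... | no _ with k ≟ j
... | yes e = contradiction e ≢j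
... | no _ = refl

transpose-< : ∀ {n} {i j : Fin n} {b} → toℕ i < b → toℕ j < b → ∀ k → toℕ (transpose i j ⟨$⟩ʳ k) < b → toℕ k < b
transpose-< {i = i} {j} {b} i< j< k h = go (k ≟ i) (k ≟ j)
  where
  go : Dec (k ≡ i) → Dec (k ≡ j) → toℕ k < b
  go (yes refl) _ = i<
  go (no _) (yes refl) = j<
  go (no k≢i) (no k≢j) = subst (λ l → toℕ l < b) (transpose-other k≢i k≢j) h

-- Convexity in q

-- Adjacency in `Gnck` up to distinctness of the ends: `a` dominating positions, and a clique on the
-- first `b` positions.
Thr : ℕ → ℕ → ℕ → ℕ → Set
Thr a b i j = i < a ⊎ j < a ⊎ (i < b × j < b)

Gnck⇒Thr : ∀ {n} c q {i j : Fin n} → adj (Gnck n c q) i j ≡ true → Thr q (c + 1 ∸ q) (toℕ i) (toℕ j)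
Gnck⇒Thr c q {i} {j} e with toℕ i <ᵇ q in e₁ | toℕ j <ᵇ q in e₂ | ∧-elim {not (toℕ i ≡ᵇ toℕ j)} e
... | true  | _     | _ = inj₁ (<ᵇ-elim e₁)
... | false | true  | _ = inj₂ (inj₁ (<ᵇ-elim e₂))
... | false | false | _ , h = let h₁ , h₂ = ∧-elim h in inj₂ (inj₂ (<ᵇ-elim h₁ , <ᵇ-elim h₂))

Thr⇒Gnck : ∀ {n} c q {i j : Fin n} → i ≢ j → Thr q (c + 1 ∸ q) (toℕ i) (toℕ j) → adj (Gnck n c q) i j ≡ true
Thr⇒Gnck c q {i} {j} i≢j h = ∧-intro
  (not-intro (≢true⇒false λ t → i≢j (toℕ-injective (≡ᵇ⇒≡ _ _ (≡⇒T t))))) (go h)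
  where
  go : Thr q (c + 1 ∸ q) (toℕ i) (toℕ j) →
       (toℕ i <ᵇ q) ∨ (toℕ j <ᵇ q) ∨ ((toℕ i <ᵇ (c + 1 ∸ q)) ∧ (toℕ j <ᵇ (c + 1 ∸ q))) ≡ true
  go (inj₁ h) rewrite <ᵇ-intro h = refl
  go (inj₂ h) with toℕ i <ᵇ q
  ... | true = refl
  go (inj₂ (inj₁ h)) | false rewrite <ᵇ-intro h = refl
  go (inj₂ (inj₂ (h₁ , h₂))) | false with toℕ j <ᵇ q
  ... | true = refl
  ... | false = ∧-intro (<ᵇ-intro h₁) (<ᵇ-intro h₂)

adj⇒≢ : ∀ {n} (G : Graph n) {i j} → adj G i j ≡ true → i ≢ j
adj⇒≢ G {i} e refl = true≢false e (irrefl G i)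

-- The vertex set and the isomorphism type do not involve the host graph, so only an edge can be at
-- fault.
missing-edge : ∀ {m n} {H : Graph m} {G G′ : Graph n} {X} → Copy H G X → isCopy H G′ X ≡ false →
               ∃₂ λ i j → inF X i j ≡ true × adj G′ i j ≡ false
missing-edge {H = H} {G} {G′} {X} C e
  with any? (λ i → any? λ j → (inF X i j Bool.≟ true) ×-dec (adj G′ i j Bool.≟ false))
... | yes (i , j , h) = i , j , h
... | no ¬h = true≢false (Copy⇒isCopy {H = H} {G′}
        (Copy-mono C λ {i} {j} f → [ id , (λ a≡f → contradiction (i , j , f , a≡f) ¬h) ]′ (dichotomy (adj G′ i j)))) e
  where
  dichotomy : ∀ b → b ≡ true ⊎ b ≡ false
  dichotomy true  = inj₁ refl
  dichotomy false = inj₂ refl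

fin : ∀ {n} a → a < n → ∃ λ (i : Fin n) → toℕ i ≡ a
fin a a<n = fromℕ< a<n , toℕ-fromℕ< a<n

differ : ∀ {n} {i j : Fin n} {a b} → toℕ i ≡ a → toℕ j ≡ b → a ≢ b → i ≢ j
differ refl refl a≢b refl = a≢b refl

module Convexity {m} (H : Graph m) (cot : CoTransitive H) {n c : ℕ} (c<n : c < n) where

  Γ : ℕ → Graph n
  Γ = Gnck n c

  isC : ℕ → SubgraphData n → Bool
  isC q = isCopy H (Γ q)

  gain loss common : ℕ → ℕ
  gain q = countˢ (λ X → isC (suc q) X ∧ not (isC q X))
  loss q = countˢ (λ X → isC q X ∧ not (isC (suc q) X))
  common q = countˢ (λ X → isC q X ∧ isC (suc q) X)

  -- s = c ∸ q ∸ 1, so that the clique sizes for q, q + 1, q + 2 are s + 2, s + 1, s.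
  module _ {q s} (q<s : q + 2 < s) (eq : c + 1 ∸ q ≡ 2 + s) (s≤c : suc s ≤ c) where

    eq₁ : c + 1 ∸ (1 + q) ≡ suc s
    eq₁ = trans (sym (pred[m∸n]≡m∸[1+n] (c + 1) q)) (cong pred eq)

    eq₂ : c + 1 ∸ (2 + q) ≡ s
    eq₂ = trans (sym (pred[m∸n]≡m∸[1+n] (c + 1) (suc q))) (cong pred eq₁)

    q+2<s : suc (suc q) < s
    q+2<s = subst (_< s) (+-comm q 2) q<s

    1+q<s : suc q < s
    1+q<s = <-trans (n<1+n _) q+2<s

    0+q<s : q < s
    0+q<s = <-trans (n<1+n _) 1+q<s

    thr₁ : ∀ {i j} → adj (Γ (1 + q)) i j ≡ true → Thr (1 + q) (1 + s) (toℕ i) (toℕ j)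
    thr₁ {i} {j} e = subst (λ b → Thr (1 + q) b (toℕ i) (toℕ j)) eq₁ (Gnck⇒Thr c (1 + q) {i} {j} e)
    thr⁻ : ∀ {i j} → i ≢ j → Thr q (2 + s) (toℕ i) (toℕ j) → adj (Γ q) i j ≡ true
    thr⁻ {i} {j} i≢j h = Thr⇒Gnck c q i≢j (subst (λ b → Thr q b (toℕ i) (toℕ j)) (sym eq) h)
    thr₂⁻ : ∀ {i j} → i ≢ j → Thr (2 + q) s (toℕ i) (toℕ j) → adj (Γ (2 + q)) i j ≡ true
    thr₂⁻ {i} {j} i≢j h = Thr⇒Gnck c (2 + q) i≢j (subst (λ b → Thr (2 + q) b (toℕ i) (toℕ j)) (sym eq₂) h)

    -- The new edges of `Γ (1 + q)` join position q to positions beyond s + 1. If a copy uses such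
    -- an edge, with far end `w`, its edges are covered by the neighbours of `w`, all among the
    -- first q + 1 positions. Swapping positions q and q + 1 therefore gives a copy in `Γ (2 + q)`,
    -- and its edge from q + 1 to `w` is absent from `Γ (1 + q)`.
    gain-mono : gain q ≤ gain (suc q)
    gain-mono with fin {n} q (<-trans 0+q<s (<-trans s≤c c<n))
                 | fin {n} (suc q) (<-trans 1+q<s (<-trans s≤c c<n))
    ... | u , u≡ | v , v≡ = countˢ-injection (permute π) (λ {X} {Y} _ _ → permute-injective π {X} {Y}) (λ {X} → moves {X})
      where
      π = transpose u v

      π-below : ∀ i → toℕ (π ⟨$⟩ʳ i) < suc q → toℕ i < suc (suc q)
      π-below i h = transpose-< (≤-trans (s≤s (≤-reflexive u≡)) (m≤n⇒m≤1+n ≤-refl)) (s≤s (≤-reflexive v≡)) i (m<n⇒m<1+n h)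

      module _ {X} (C : Copy H (Γ (suc q)) X) where
        open Copy C

        high-edge : ∀ {i j} → inF X i j ≡ true → adj (Γ q) i j ≡ false →
                    ∃ λ j → inF X u j ≡ true × 2 + s ≤ toℕ j
        high-edge {i} {j} ij nij with i≢j ← adj⇒≢ (Γ (suc q)) {i} {j} (edge⇒adj ij) | thr₁ (edge⇒adj ij)
        ... | inj₁ i<1+q with m<1+n⇒m<n∨m≡n i<1+q
        ...   | inj₁ i<q = true≢false (thr⁻ i≢j (inj₁ i<q)) nij
        ...   | inj₂ i≡q with toℕ j <? 2 + s
        ...     | yes j< = true≢false (thr⁻ i≢j (inj₂ (inj₂ (<-trans i<1+q (m<n⇒m<1+n (m<n⇒m<1+n 1+q<s)) , j<)))) nij
        ...     | no j≮ = j , subst (λ i → inF X i j ≡ true) (toℕ-injective (trans i≡q (sym u≡))) ij , ≮⇒≥ j≮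
        high-edge {i} {j} ij nij | inj₂ (inj₁ j<1+q) with m<1+n⇒m<n∨m≡n j<1+q
        ...   | inj₁ j<q = true≢false (thr⁻ i≢j (inj₂ (inj₁ j<q))) nij
        ...   | inj₂ j≡q with toℕ i <? 2 + s
        ...     | yes i< = true≢false (thr⁻ i≢j (inj₂ (inj₂ (i< , <-trans j<1+q (m<n⇒m<1+n (m<n⇒m<1+n 1+q<s)))))) nij
        ...     | no i≮ = i , subst (λ j → inF X j i ≡ true) (toℕ-injective (trans j≡q (sym u≡))) (trans (edge-sym j i) ij) , ≮⇒≥ i≮
        high-edge ij nij | inj₂ (inj₂ (i< , j<)) =
          true≢false (thr⁻ i≢j (inj₂ (inj₂ (m<n⇒m<1+n i< , m<n⇒m<1+n j<)))) nij

        low-end : ∀ {i w} → 2 + s ≤ toℕ w → inF X i w ≡ true → toℕ i < suc q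
        low-end w≥ iw with thr₁ (edge⇒adj iw)
        ... | inj₁ h = h
        ... | inj₂ (inj₁ h) = contradiction (≤-trans w≥ (<⇒≤ h)) (<⇒≱ (m<n⇒m<1+n (m<n⇒m<1+n 1+q<s)))
        ... | inj₂ (inj₂ (_ , h)) = contradiction (≤-trans w≥ (<⇒≤ h)) (<⇒≱ ≤-refl)

        image : ∀ {w} → inF X u w ≡ true → 2 + s ≤ toℕ w → Copy H (Γ (2 + q)) (permute π X)
        image {w} uw w≥ = Copy-permute π C λ i j h →
          thr₂⁻ (λ { refl → adj⇒≢ (Γ (suc q)) {π ⟨$⟩ʳ i} (edge⇒adj h) refl }) (cover i j h)
          where
          cover : ∀ i j → inF X (π ⟨$⟩ʳ i) (π ⟨$⟩ʳ j) ≡ true → Thr (2 + q) s (toℕ i) (toℕ j)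
          cover i j h with copy-cotransitive cot C (edge⇒inS (trans (edge-sym w u) uw)) h
          ... | inj₁ iw = inj₁ (π-below i (low-end w≥ iw))
          ... | inj₂ wj = inj₂ (inj₁ (π-below j (low-end w≥ (trans (edge-sym _ _) wj))))

        image-not : ∀ {w} → inF X u w ≡ true → 2 + s ≤ toℕ w → ¬ Copy H (Γ (1 + q)) (permute π X)
        image-not {w} uw w≥ C′ with thr₁ (Copy.edge⇒adj C′ {v} {w} vw)
          where
          big : ∀ {i a} → toℕ i ≡ a → a < 2 + s → w ≢ i
          big refl lt refl = <⇒≱ lt w≥
          vw : inF (permute π X) v w ≡ true
          vw = trans (inF-permute π X v w) (trans (cong₂ (inF X) (transpose-right u v)
                 (transpose-other (big u≡ (m<n⇒m<1+n (m<n⇒m<1+n 0+q<s)))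
                                  (big v≡ (m<n⇒m<1+n (m<n⇒m<1+n 1+q<s))))) uw)
        ... | inj₁ h = n≮n _ (subst (_< suc q) v≡ h)
        ... | inj₂ (inj₁ h) = contradiction (≤-trans w≥ (<⇒≤ h)) (<⇒≱ (m<n⇒m<1+n (m<n⇒m<1+n 1+q<s)))
        ... | inj₂ (inj₂ (_ , h)) = contradiction (≤-trans w≥ (<⇒≤ h)) (<⇒≱ ≤-refl)

      moves : ∀ {X} → isC (suc q) X ∧ not (isC q X) ≡ true →
              isC (2 + q) (permute π X) ∧ not (isC (suc q) (permute π X)) ≡ true
      moves {X} h with ∧-elim {isC (suc q) X} h
      ... | h₁ , h₂ with C ← isCopy⇒Copy {H = H} {Γ (suc q)} X h₁
                    with missing-edge {H = H} {Γ (suc q)} {Γ q} {X} C (not-elim h₂)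
      ... | i , j , ij , nij with high-edge C ij nij
      ... | w , uw , w≥ = ∧-intro (Copy⇒isCopy (image C uw w≥))
              (not-intro (≢true⇒false λ t → image-not C uw w≥ (isCopy⇒Copy _ t)))

    -- The edges of `Γ (1 + q)` missing from `Γ (2 + q)` join position s to positions from q + 2 to
    -- s - 1. Neither end has neighbours beyond position s, and every vertex of the copy is adjacent
    -- to one of the ends, so the whole copy lies in the first s + 1 positions. Swapping s and s + 1
    -- leaves it inside the clique on the first s + 2 positions of `Γ q`, with an edge at s + 1 that
    -- `Γ (1 + q)` lacks.
    loss-antitone : loss (suc q) ≤ loss q
    loss-antitone with fin {n} s (<-trans s≤c c<n) | fin {n} (suc s) (≤-<-trans s≤c c<n)
    ... | u , u≡ | v , v≡ = countˢ-injection (permute π) (λ {X} {Y} _ _ → permute-injective π {X} {Y}) (λ {X} → moves {X})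
      where
      π = transpose u v

      π-below : ∀ i → toℕ (π ⟨$⟩ʳ i) < suc s → toℕ i < suc (suc s)
      π-below i h = transpose-< (≤-trans (s≤s (≤-reflexive u≡)) (m≤n⇒m≤1+n ≤-refl)) (s≤s (≤-reflexive v≡)) i (m<n⇒m<1+n h)

      module _ {X} (C : Copy H (Γ (suc q)) X) where
        open Copy C

        top-edge : ∀ {i j} → inF X i j ≡ true → adj (Γ (2 + q)) i j ≡ false →
                   ∃ λ i → inF X i u ≡ true × 2 + q ≤ toℕ i × toℕ i < s
        top-edge {i} {j} ij nij with i≢j ← adj⇒≢ (Γ (suc q)) {i} {j} (edge⇒adj ij) | toℕ i <? 2 + q | toℕ j <? 2 + q
        ... | yes i< | _ = true≢false (thr₂⁻ i≢j (inj₁ i<)) nij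
        ... | no _ | yes j< = true≢false (thr₂⁻ i≢j (inj₂ (inj₁ j<))) nij
        ... | no i≮ | no j≮ with thr₁ (edge⇒adj ij)
        ... | inj₁ h = contradiction (m<n⇒m<1+n h) i≮
        ... | inj₂ (inj₁ h) = contradiction (m<n⇒m<1+n h) j≮
        ... | inj₂ (inj₂ (i<1+s , j<1+s)) with m<1+n⇒m<n∨m≡n i<1+s | m<1+n⇒m<n∨m≡n j<1+s
        ... | inj₁ i<s | inj₁ j<s = true≢false (thr₂⁻ i≢j (inj₂ (inj₂ (i<s , j<s)))) nij
        ... | inj₁ i<s | inj₂ j≡s = i , subst (λ j → inF X i j ≡ true) (toℕ-injective (trans j≡s (sym u≡))) ij , ≮⇒≥ i≮ , i<s
        ... | inj₂ i≡s | inj₁ j<s = j , subst (λ i → inF X j i ≡ true) (toℕ-injective (trans i≡s (sym u≡))) (trans (edge-sym j i) ij) , ≮⇒≥ j≮ , j<s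
        ... | inj₂ i≡s | inj₂ j≡s = contradiction (toℕ-injective (trans i≡s (sym j≡s))) i≢j

        module _ {i₀} (iu : inF X i₀ u ≡ true) (lo : 2 + q ≤ toℕ i₀) (hi : toℕ i₀ < s) where

          nbr-below : ∀ {i w} → 2 + q ≤ toℕ i → inF X i w ≡ true → toℕ w < suc s
          nbr-below i≥ iw with thr₁ (edge⇒adj iw)
          ... | inj₁ h = contradiction (≤-trans i≥ (<⇒≤ h)) (<⇒≱ ≤-refl)
          ... | inj₂ (inj₁ h) = <-trans h (m<n⇒m<1+n 1+q<s)
          ... | inj₂ (inj₂ (_ , h)) = h

          all-below : ∀ {w} → inS X w ≡ true → toℕ w < suc s
          all-below w∈ with copy-cotransitive cot C w∈ iu
          ... | inj₁ iw = nbr-below lo iw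
          ... | inj₂ wu = nbr-below (≤-trans (<⇒≤ q+2<s) (≤-reflexive (sym u≡))) (trans (edge-sym u _) wu)

          image : Copy H (Γ q) (permute π X)
          image = Copy-permute π C λ i j h →
            thr⁻ (λ { refl → adj⇒≢ (Γ (suc q)) {π ⟨$⟩ʳ i} (edge⇒adj h) refl })
              (inj₂ (inj₂ (π-below i (all-below (edge⇒inS h)) ,
                           π-below j (all-below (edge⇒inS (trans (edge-sym _ _) h))))))

          image-not : ¬ Copy H (Γ (1 + q)) (permute π X)
          image-not C′ with thr₁ (Copy.edge⇒adj C′ {i₀} {v} iv)
            where
            iv : inF (permute π X) i₀ v ≡ true
            iv = trans (inF-permute π X i₀ v) (trans (cong₂ (inF X)
                   (transpose-other (differ refl u≡ (<⇒≢ hi)) (differ refl v≡ (<⇒≢ (m<n⇒m<1+n hi))))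
                   (transpose-right u v)) iu)
          ... | inj₁ h = <⇒≱ h (<⇒≤ lo)
          ... | inj₂ (inj₁ h) = <⇒≱ (subst (_< suc q) v≡ h) (m≤n⇒m≤1+n (<⇒≤ 1+q<s))
          ... | inj₂ (inj₂ (_ , h)) = n≮n _ (subst (_< suc s) v≡ h)

      moves : ∀ {X} → isC (suc q) X ∧ not (isC (2 + q) X) ≡ true →
              isC q (permute π X) ∧ not (isC (suc q) (permute π X)) ≡ true
      moves {X} h with ∧-elim {isC (suc q) X} h
      ... | h₁ , h₂ with C ← isCopy⇒Copy {H = H} {Γ (suc q)} X h₁
                    with missing-edge {H = H} {Γ (suc q)} {Γ (2 + q)} {X} C (not-elim h₂)
      ... | i , j , ij , nij with top-edge C ij nij
      ... | i₀ , iu , lo , hi = ∧-intro (Copy⇒isCopy (image C iu lo hi))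
              (not-intro (≢true⇒false λ t → image-not C iu lo hi (isCopy⇒Copy _ t)))

  ∧-swap : ∀ a b → a ∧ b ≡ true → b ∧ a ≡ true
  ∧-swap true true e = refl

  N-as-loss : ∀ q → N H (Γ q) ≡ common q + loss q
  N-as-loss q = count-split (allSubgraphData n) (isC q) (isC (suc q))

  N-as-gain : ∀ q → N H (Γ (suc q)) ≡ common q + gain q
  N-as-gain q = trans (count-split (allSubgraphData n) (isC (suc q)) (isC q))
    (cong (_+ gain q) (≤-antisym (swap (isC (suc q)) (isC q)) (swap (isC q) (isC (suc q)))))
    where
    swap : (a b : SubgraphData n → Bool) → countˢ (λ X → a X ∧ b X) ≤ countˢ (λ X → b X ∧ a X)
    swap a b = countˢ-injection {q = λ X → b X ∧ a X} id (λ _ _ e → e) λ {X} → ∧-swap (a X) (b X)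

  -- After the copies common to consecutive graphs cancel, what remains is `gain q + loss (1 + q) ≤
  -- gain (1 + q) + loss q`.
  N-convex : ∀ q → q + q + 4 ≤ c → N H (Γ (1 + q)) + N H (Γ (1 + q)) ≤ N H (Γ q) + N H (Γ (2 + q))
  N-convex q le with m≤n⇒∃[o]m+o≡n le
  ... | e , refl = begin
      N H (Γ (1 + q)) + N H (Γ (1 + q))                         ≡⟨ cong₂ _+_ (N-as-gain q) (N-as-loss (1 + q)) ⟩
      (common q + gain q) + (common (1 + q) + loss (1 + q))      ≤⟨ +-mono-≤ (+-monoʳ-≤ (common q) gm) (+-monoʳ-≤ (common (1 + q)) lm) ⟩
      (common q + gain (1 + q)) + (common (1 + q) + loss q)      ≡⟨ rearrange (common q) (gain (1 + q)) (common (1 + q)) (loss q) ⟩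
      (common q + loss q) + (common (1 + q) + gain (1 + q))      ≡⟨ cong₂ _+_ (N-as-loss q) (N-as-gain (1 + q)) ⟨
      N H (Γ q) + N H (Γ (2 + q))                               ∎
    where
    open ≤-Reasoning
    open +-*-Solver
    rearrange : ∀ a b c d → (a + b) + (c + d) ≡ (a + d) + (c + b)
    rearrange = solve 4 (λ a b c d → (a :+ b) :+ (c :+ d) := (a :+ d) :+ (c :+ b)) refl
    -- With c = 2q + 4 + e this is c - q - 1.
    s = q + 3 + e
    q<s : q + 2 < s
    q<s = ≤-trans (≤-reflexive (sym (+-suc q 2))) (m≤m+n (q + 3) e)
    eqs : q + q + 4 + e + 1 ∸ q ≡ 2 + s
    eqs = trans (cong (_∸ q) (solve 2 (λ q e → q :+ q :+ con 4 :+ e :+ con 1 := q :+ (con 2 :+ (q :+ con 3 :+ e))) refl q e)) (m+n∸m≡n q _)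
    s≤ : suc s ≤ q + q + 4 + e
    s≤ = ≤-trans (m≤n+m (suc s) q) (≤-reflexive (solve 2 (λ q e → q :+ (con 1 :+ (q :+ con 3 :+ e)) := q :+ q :+ con 4 :+ e) refl q e))
    gm = gain-mono q<s eqs s≤
    lm = loss-antitone q<s eqs s≤

-- Induction on the right end. If the last step does not descend, the bound for the shorter range
-- passes to the new end. If it descends, convexity makes every earlier step descend as well, and
-- `f k` dominates.
convex⇒≤ends : (f : ℕ → ℕ) (k t : ℕ) → (∀ q → k ≤ q → 2 + q ≤ t → f (1 + q) + f (1 + q) ≤ f q + f (2 + q)) →
               ∀ q → k ≤ q → q ≤ t → f q ≤ f k ⊔ f t
convex⇒≤ends f k zero conv q k≤q z≤n with k≤q
... | z≤n = m≤m⊔n (f 0) (f 0)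
convex⇒≤ends f k (suc t) conv q k≤q q≤t with m≤n⇒m<n∨m≡n q≤t
... | inj₂ refl = m≤n⊔m (f k) (f q)
... | inj₁ (s≤s q≤t′) with f t ≤? f (suc t)
... | yes up = ≤-trans (convex⇒≤ends f k t (λ r k≤r h → conv r k≤r (m≤n⇒m≤1+n h)) q k≤q q≤t′) (⊔-monoʳ-≤ (f k) up)
... | no ¬up = ≤-trans (convex⇒≤ends f k t (λ r k≤r h → conv r k≤r (m≤n⇒m≤1+n h)) q k≤q q≤t′)
                 (⊔-lub (m≤m⊔n (f k) _) (≤-trans (down t (≤-trans k≤q q≤t′) ≤-refl (≰⇒> ¬up)) (m≤m⊔n (f k) _)))
  where
  down : ∀ r → k ≤ r → suc r ≤ suc t → f (suc r) < f r → f r ≤ f k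
  down r k≤r r≤t lt with m≤n⇒m<n∨m≡n k≤r
  ... | inj₂ refl = ≤-refl
  down (suc r) k≤r r≤t lt | inj₁ (s≤s k≤r′) =
    ≤-trans (<⇒≤ lt′) (down r k≤r′ (≤-trans (n≤1+n _) r≤t) lt′)
    where
    lt′ : f (suc r) < f r
    lt′ = ≰⇒> λ le → <⇒≱ (+-mono-≤-< le lt) (conv r k≤r′ r≤t)

-- Degenerate orderings

⟨$⟩ʳ-injective : ∀ {n} (π : Permutation′ n) {i j} → π ⟨$⟩ʳ i ≡ π ⟨$⟩ʳ j → i ≡ j
⟨$⟩ʳ-injective π e = trans (sym (inverseˡ π)) (trans (cong (π ⟨$⟩ˡ_) e) (inverseˡ π))

countᶠ-true : ∀ l → countᶠ {l} (λ _ → true) ≡ l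
countᶠ-true l = trans (cong length (filter-all (λ _ → T? true) (All.tabulate {xs = allFin l} λ _ → _))) (length-tabulate id)

initial-≤-countᶠ : ∀ {n} {p : Fin n → Bool} {l} → l ≤ n → (∀ i → toℕ i < l → p i ≡ true) → l ≤ countᶠ p
initial-≤-countᶠ {p = p} {l} l≤n h = ≤-trans (≤-reflexive (sym (countᶠ-true l)))
  (countᶠ-injection (λ i → inject≤ i l≤n) (λ _ _ → inject≤-injective l≤n l≤n _ _)
    (λ {i} _ → h _ (subst (_< l) (sym (toℕ-inject≤ i l≤n)) (toℕ<n i))))

-- Sifting from the top: the highest position allowed, if it belongs to `A`, is exchanged with a
-- lower position outside `A`, which exists because `A` has at most `q` members. Fixing all
-- positions from `d + q` on keeps the last vertex of a copy in place.
compress : ∀ {n} q d (A : Fin n → Bool) → (∀ i → A i ≡ true → toℕ i < d + q) → countᶠ A ≤ q →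
           Σ (Permutation′ n) λ π → (∀ i → d + q ≤ toℕ i → π ⟨$⟩ʳ i ≡ i) ×
                                    (∀ i → A (π ⟨$⟩ʳ i) ≡ true → toℕ i < q)
compress q zero A bd c≤ = idₚ , (λ _ _ → refl) , bd
compress {n} q (suc d) A bd c≤ with d + q <? n
-- There is no position `d + q`, so the bound on `A` can be lowered at no cost.
... | no ≮n = let π , fx , im = compress q d A (λ i _ → <-≤-trans (toℕ<n i) (≮⇒≥ ≮n)) c≤
              in π , (λ i h → fx i (<⇒≤ h)) , im
... | yes <n with fin (d + q) <n
... | w , w≡ with A w in eqw
... | false = let π , fx , im = compress q d A bd′ c≤ in π , (λ i h → fx i (<⇒≤ h)) , im
  where
  bd′ : ∀ i → A i ≡ true → toℕ i < d + q
  bd′ i Ai with m<1+n⇒m<n∨m≡n (bd i Ai)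
  ... | inj₁ h = h
  ... | inj₂ e = true≢false (subst (λ i → A i ≡ true) (toℕ-injective (trans e (sym w≡))) Ai) eqw
... | true with any? (λ j → (toℕ j <? d + q) ×-dec (A j Bool.≟ false))
... | no all = contradiction (≤-trans (initial-≤-countᶠ <n full) c≤) (<⇒≱ (s≤s (m≤n+m q d)))
  where
  full : ∀ i → toℕ i < suc (d + q) → A i ≡ true
  full i h with A i in eqi
  ... | true = refl
  ... | false with m<1+n⇒m<n∨m≡n h
  ... | inj₁ lt = contradiction (i , lt , eqi) all
  ... | inj₂ e = true≢false eqw (subst (λ i → A i ≡ false) (toℕ-injective (trans e (sym w≡))) eqi)
... | yes (j , j< , Aj) = let π , fx , im = compress q d (λ i → A (τ ⟨$⟩ʳ i)) bd′ c≤′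
                          in π ∘ₚ τ , (λ i h → trans (cong (τ ⟨$⟩ʳ_) (fx i (<⇒≤ h))) (fixed i h)) , im
  where
  τ = transpose w j
  c≤′ = ≤-trans (countᶠ-injection (τ ⟨$⟩ʳ_) (λ _ _ → ⟨$⟩ʳ-injective τ) id) c≤
  fixed : ∀ i → suc (d + q) ≤ toℕ i → τ ⟨$⟩ʳ i ≡ i
  fixed i h = transpose-other (differ refl w≡ (>⇒≢ h)) (differ refl refl (>⇒≢ (<-trans j< h)))
  bd′ : ∀ i → A (τ ⟨$⟩ʳ i) ≡ true → toℕ i < d + q
  bd′ i Ai = go (i ≟ w) (i ≟ j)
    where
    go : Dec (i ≡ w) → Dec (i ≡ j) → toℕ i < d + q
    go (yes refl) _ = true≢false (subst (λ k → A k ≡ true) (transpose-left w j) Ai) Aj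
    go (no _) (yes refl) = j<
    go (no i≢w) (no i≢j) with m<1+n⇒m<n∨m≡n (bd i (subst (λ k → A k ≡ true) (transpose-other i≢w i≢j) Ai))
    ... | inj₁ h = h
    ... | inj₂ e = contradiction (toℕ-injective (trans e (sym w≡))) i≢w

-- One more than the last position holding `true`, and 0 for the empty set. On the vertex set of a
-- copy, this is the value that selects its permutation.
top : ∀ {n} → Vec Bool n → ℕ
top [] = 0
top (b ∷ v) with top v
... | suc k = suc (suc k)
... | zero with b
... | true  = 1
... | false = 0

top-bound : ∀ {n} (v : Vec Bool n) i → lookup v i ≡ true → toℕ i < top v
top-bound (b ∷ v) i e with top v | top-bound v
top-bound (b ∷ v) zero e | suc k | h = s≤s z≤n
top-bound (b ∷ v) (suc i) e | suc k | h = s≤s (h i e)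
top-bound (true ∷ v) zero e | zero | h = s≤s z≤n
top-bound (b ∷ v) (suc i) e | zero | h = contradiction (h i e) λ ()

top-attained : ∀ {n} (v : Vec Bool n) {k} → top v ≡ suc k → ∃ λ i → toℕ i ≡ k × lookup v i ≡ true
top-attained (b ∷ v) e with top v | top-attained v
top-attained (b ∷ v) refl | suc k | h = let i , i≡ , vi = h refl in suc i , cong suc i≡ , vi
top-attained (true ∷ v) refl | zero | h = zero , refl , refl

top-unique : ∀ {n} (v : Vec Bool n) {i} → lookup v i ≡ true → (∀ j → lookup v j ≡ true → toℕ j ≤ toℕ i) → top v ≡ suc (toℕ i)
top-unique v {i} vi h with top v in eq | top-bound v i vi
... | suc k | s≤s i≤k = let j , j≡ , vj = top-attained v eq
                        in cong suc (≤-antisym (subst (_≤ toℕ i) j≡ (h j vj)) i≤k)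

BackDegree : ∀ {n} → Graph n → Permutation′ n → Fin n → ℕ
BackDegree G ρ v = countᶠ (λ u → adj G v u ∧ (toℕ (ρ ⟨$⟩ʳ u) <ᵇ toℕ (ρ ⟨$⟩ʳ v)))

-- The first `m` positions are unconstrained: for `m = c + 1 ∸ q` they form a clique in `Gnck n c q`
-- anyway.
Degenerate : ∀ {n} → Graph n → (q m : ℕ) → Permutation′ n → Set
Degenerate G q m ρ = ∀ v → m ≤ toℕ (ρ ⟨$⟩ʳ v) → BackDegree G ρ v ≤ q

module _ {m n} (H : Graph m) (cot : CoTransitive H) (G : Graph n) {c q : ℕ} (q≤ : q ≤ c + 1 ∸ q)
         (deg : Degenerate G q (c + 1 ∸ q) idₚ) where

  private
    l = c + 1 ∸ q

    Compresses : Fin n → Permutation′ n → Set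
    Compresses z π = (∀ i → toℕ z < toℕ i → π ⟨$⟩ʳ i ≡ i) × π ⟨$⟩ʳ z ≡ z ×
      (l ≤ toℕ z → ∀ i → adj G z (π ⟨$⟩ʳ i) ≡ true → toℕ (π ⟨$⟩ʳ i) < toℕ z → toℕ i < q)

    choice : (t : ℕ) → Σ (Permutation′ n) λ π → ∀ z → t ≡ ℕ.suc (toℕ z) → Compresses z π
    choice zero = idₚ , λ z ()
    choice (suc t) with t <? n | l ≤? t
    ... | no t≮n | _ = idₚ , λ { z refl → contradiction (toℕ<n z) t≮n }
    -- A copy that ends before position `l` already lies in the clique of `Gnck n c q`, so nothing
    -- has to move.
    ... | yes t<n | no l≰t = idₚ , λ { z refl → (λ _ _ → refl) , refl , λ h → contradiction h l≰t }
    ... | yes t<n | yes l≤t with fin t t<n | m≤n⇒∃[o]m+o≡n (≤-trans q≤ l≤t)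
    ... | w , refl | d , q+d≡ with compress q d (λ u → adj G w u ∧ (toℕ u <ᵇ toℕ w))
              (λ i h → subst (toℕ i <_) (trans (sym q+d≡) (+-comm q d)) (<ᵇ-elim (proj₂ (∧-elim {adj G w i} h)))) (deg w l≤t)
    ... | π , fx , im = π , spec
      where
      d+q≤ : ∀ {a} → toℕ w ≤ a → d + q ≤ a
      d+q≤ = ≤-trans (≤-reflexive (trans (+-comm d q) q+d≡))
      spec : ∀ z → ℕ.suc (toℕ w) ≡ ℕ.suc (toℕ z) → Compresses z π
      spec z e with toℕ-injective (suc-injective e)
      ... | refl = (λ i h → fx i (d+q≤ (<⇒≤ h))) , fx z (d+q≤ ≤-refl) ,
                   λ _ i a lt → im i (∧-intro a (<ᵇ-intro lt))

    πs : ℕ → Permutation′ n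
    πs t = proj₁ (choice t)

    shift : SubgraphData n → SubgraphData n
    shift X = permute (πs (top (proj₁ X))) X

    module _ {X : SubgraphData n} {k} (top≡ : top (proj₁ X) ≡ suc k) where

      z : Fin n
      z = proj₁ (top-attained (proj₁ X) top≡)
      z≡ : toℕ z ≡ k
      z≡ = proj₁ (proj₂ (top-attained (proj₁ X) top≡))
      z∈ : inS X z ≡ true
      z∈ = proj₂ (proj₂ (top-attained (proj₁ X) top≡))
      π = πs (top (proj₁ X))
      spec : Compresses z π
      spec = proj₂ (choice (top (proj₁ X))) z (trans top≡ (cong suc (sym z≡)))

      ≤z : ∀ i → inS X i ≡ true → toℕ i ≤ toℕ z
      ≤z i h = ≤-trans (≤-pred (subst (toℕ i <_) top≡ (top-bound (proj₁ X) i h))) (≤-reflexive (sym z≡))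

      π⁻-≤z : ∀ i → inS X (π ⟨$⟩ʳ i) ≡ true → toℕ i ≤ toℕ z
      π⁻-≤z i h = ≮⇒≥ λ z<i → <⇒≱ z<i (subst (λ j → toℕ j ≤ toℕ z) (proj₁ spec i z<i) (≤z _ h))

      top-shift : top (proj₁ (shift X)) ≡ top (proj₁ X)
      top-shift = trans (top-unique (proj₁ (shift X)) {z}
          (trans (inS-permute π X z) (trans (cong (inS X) (proj₁ (proj₂ spec))) z∈))
          (λ j h → π⁻-≤z j (trans (sym (inS-permute π X j)) h)))
        (trans (cong suc z≡) (sym top≡))

      -- Either the last vertex `z`, and with it the whole copy, lies in the first `l` positions, or
      -- the edges are covered by the neighbours of `z`. These precede `z` and have been compressed
      -- into the first `q` positions.
      shift-thr : Copy H G X → ∀ i j → inF X (π ⟨$⟩ʳ i) (π ⟨$⟩ʳ j) ≡ true → Thr q l (toℕ i) (toℕ j)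
      shift-thr C i j h with l ≤? toℕ z
      ... | no l≰ = inj₂ (inj₂ (≤-<-trans (π⁻-≤z i (edge⇒inS h)) (≰⇒> l≰) ,
                                ≤-<-trans (π⁻-≤z j (edge⇒inS (trans (edge-sym _ _) h))) (≰⇒> l≰)))
        where open Copy C
      ... | yes l≤ = [ (λ iz → inj₁ (low i (trans (edge-sym _ _) iz))) , (λ zj → inj₂ (inj₁ (low j zj))) ]′
                       (copy-cotransitive cot C z∈ h)
        where
        open Copy C
        low : ∀ i → inF X z (π ⟨$⟩ʳ i) ≡ true → toℕ i < q
        low i e = proj₂ (proj₂ spec) l≤ i (edge⇒adj e)
          (≤∧≢⇒< (≤z _ (edge⇒inS (trans (edge-sym _ _) e))) (adj⇒≢ G (edge⇒adj e) ∘ sym ∘ toℕ-injective))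

    top-shift′ : ∀ X → top (proj₁ (shift X)) ≡ top (proj₁ X)
    top-shift′ X with top (proj₁ X) in eq
    ... | suc k = trans (cong (λ t → top (proj₁ (permute (πs t) X))) (sym eq)) (trans (top-shift {X} eq) eq)
    ... | zero with top (proj₁ (permute (πs 0) X)) in eq′
    ... | zero = refl
    ... | suc k = let i , _ , h = top-attained (proj₁ (permute (πs 0) X)) eq′
                  in contradiction (subst (toℕ i <_) eq (top-bound (proj₁ X) i (trans (sym (inS-permute (πs 0) X i)) h))) λ ()

    shift-injective : ∀ {X Y} → shift X ≡ shift Y → X ≡ Y
    shift-injective {X} {Y} e = permute-injective (πs (top (proj₁ Y))) {X} {Y}
      (trans (cong (λ t → permute (πs t) X) t≡) e)
      where
      t≡ : top (proj₁ Y) ≡ top (proj₁ X)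
      t≡ = trans (sym (top-shift′ Y)) (trans (cong (top ∘ proj₁) (sym e)) (top-shift′ X))

    shift-Copy : ∀ {X} → Copy H G X → Copy H (Gnck n c q) (shift X)
    shift-Copy {X} C = Copy-permute (πs (top (proj₁ X))) C λ i j h →
      Thr⇒Gnck c q (λ { refl → adj⇒≢ G {πs (top (proj₁ X)) ⟨$⟩ʳ i} (edge⇒adj h) refl }) (cover i j h)
      where
      open Copy C
      cover : ∀ i j → inF X (πs (top (proj₁ X)) ⟨$⟩ʳ i) (πs (top (proj₁ X)) ⟨$⟩ʳ j) ≡ true → Thr q l (toℕ i) (toℕ j)
      cover i j h = go (top (proj₁ X)) refl
        where
        go : ∀ t → top (proj₁ X) ≡ t → Thr q l (toℕ i) (toℕ j)
        go zero eq = contradiction (subst (toℕ (πs (top (proj₁ X)) ⟨$⟩ʳ i) <_) eq (top-bound (proj₁ X) _ (edge⇒inS h))) n≮0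
        go (suc k) eq = shift-thr {X} eq C i j h

  N-degenerate-id : N H G ≤ N H (Gnck n c q)
  N-degenerate-id = countˢ-injection shift (λ _ _ → shift-injective)
    λ {X} h → Copy⇒isCopy (shift-Copy (isCopy⇒Copy X h))

relabel : ∀ {n} → Permutation′ n → Graph n → Graph n
relabel ρ G = record
  { adj = λ i j → adj G (ρ ⟨$⟩ˡ i) (ρ ⟨$⟩ˡ j)
  ; sym = λ i j → adj-sym G _ _
  ; irrefl = λ i → irrefl G _ }

N-relabel : ∀ {m n} (H : Graph m) (ρ : Permutation′ n) (G : Graph n) → N H G ≤ N H (relabel ρ G)
N-relabel H ρ G = countˢ-injection (permute (flip ρ)) (λ _ _ → permute-injective (flip ρ)) λ {X} h →
  let C = isCopy⇒Copy {H = H} {G} X h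
  in Copy⇒isCopy {H = H} {relabel ρ G} (Copy-permute (flip ρ) C λ _ _ → Copy.edge⇒adj C)

N-degenerate : ∀ {m n} (H : Graph m) → CoTransitive H → (G : Graph n) → ∀ {c q} → q ≤ c + 1 ∸ q →
               ∀ ρ → Degenerate G q (c + 1 ∸ q) ρ → N H G ≤ N H (Gnck n c q)
N-degenerate H cot G {c} {q} q≤ ρ deg = ≤-trans (N-relabel H ρ G)
  (N-degenerate-id H cot (relabel ρ G) q≤ λ v h →
    ≤-trans (countᶠ-injection (ρ ⟨$⟩ˡ_) (λ _ _ → ⟨$⟩ʳ-injective (flip ρ))
              λ {u} e → let a , b = ∧-elim {adj G (ρ ⟨$⟩ˡ v) (ρ ⟨$⟩ˡ u)} e
                        in ∧-intro a (subst₂ (λ x y → (toℕ x <ᵇ toℕ y) ≡ true) (sym (inverseʳ ρ)) (sym (inverseʳ ρ)) b))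
            (deg (ρ ⟨$⟩ˡ v) (subst (λ x → c + 1 ∸ q ≤ toℕ x) (sym (inverseʳ ρ)) h)))

-- Paths and crossings

∈-reverse⁻ : ∀ {x : A} xs → x ∈ reverse xs → x ∈ xs
∈-reverse⁻ xs = reverse⁻

Disjoint : List A → List A → Set
Disjoint xs ys = ∀ {z} → z ∈ xs → z ∈ ys → ⊥

Unique-++⁻ : ∀ (xs : List A) {ys} → Unique (xs ++ ys) → Unique xs × Unique ys × Disjoint xs ys
Unique-++⁻ [] u = [] , u , λ ()
Unique-++⁻ (x ∷ xs) u′@(h ∷ u) with Unique-++⁻ xs u
... | ux , uy , dj = All.++⁻ˡ xs h ∷ ux , uy , dj′
  where
  dj′ : Disjoint (x ∷ xs) _
  dj′ (here refl) z∈ = Unique-head u′ (∈-++⁺ʳ xs z∈)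
  dj′ (there z∈) z∈′ = dj z∈ z∈′

_++ᵘ_[_] : {xs ys : List A} → Unique xs → Unique ys → Disjoint xs ys → Unique (xs ++ ys)
u ++ᵘ v [ d ] = Unique-++⁺ u v (λ (a , b) → d a b)

Unique-reverse : (xs : List A) → Unique xs → Unique (reverse xs)
Unique-reverse [] u = []
Unique-reverse (x ∷ xs) u@(_ ∷ uxs) = subst Unique (sym (unfold-reverse x xs))
  (Unique-reverse xs uxs ++ᵘ [] ∷ [] [ (λ { z∈ (here refl) → Unique-head u (∈-reverse⁻ xs z∈) }) ])

Linked-++⁻ : ∀ {R : A → A → Set} xs {ys} → Linked R (xs ++ ys) → Linked R xs × Linked R ys
Linked-++⁻ [] l = [] , l
Linked-++⁻ (x ∷ []) [-] = [-] , []
Linked-++⁻ (x ∷ []) (_ ∷ l) = [-] , l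
Linked-++⁻ (x ∷ y ∷ xs) (r ∷ l) with Linked-++⁻ (y ∷ xs) l
... | l₁ , l₂ = r ∷ l₁ , l₂

AllPairs-++⁻ : ∀ {R : A → A → Set} xs {ys} → AllPairs R (xs ++ ys) → ∀ {x y} → x ∈ xs → y ∈ ys → R x y
AllPairs-++⁻ (x ∷ xs) (h ∷ p) (here refl) y∈ = All.lookup h (∈-++⁺ʳ xs y∈)
AllPairs-++⁻ (x ∷ xs) (h ∷ p) (there x∈) y∈ = AllPairs-++⁻ xs p x∈ y∈

-- The relation is arbitrary because the same facts are needed for `G` and for `G` with a universal
-- vertex added.
module Path {A : Set} (R : A → A → Bool) where

  infixr 5 _∷_

  data Pth : A → List A → A → Set where
    end : ∀ x → Pth x (x ∷ []) x
    _∷_ : ∀ {x y L z} → R x y ≡ true → Pth y L z → Pth x (x ∷ L) z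

  Pth-head : ∀ {x y u L} → Pth x (u ∷ L) y → x ≡ u
  Pth-head (end _) = refl
  Pth-head (_ ∷ _) = refl

  Pth-start : ∀ {x L y} → Pth x L y → x ∈ L
  Pth-start (end _) = here refl
  Pth-start (_ ∷ _) = here refl

  Pth-end : ∀ {x L y} → Pth x L y → y ∈ L
  Pth-end (end _) = here refl
  Pth-end (_ ∷ p) = there (Pth-end p)

  join : ∀ {x L y z M w} → Pth x L y → R y z ≡ true → Pth z M w → Pth x (L ++ M) w
  join (end _) r q = r ∷ q
  join (r′ ∷ p) r q = r′ ∷ join p r q

  split : ∀ {x y c} L M → Pth x (L ++ c ∷ M) y → Pth x (L ++ c ∷ []) c × Pth c (c ∷ M) y
  split [] M p with refl ← Pth-head p = end _ , p
  split (u ∷ []) M (r ∷ p) with refl ← Pth-head p = r ∷ end _ , p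
  split (u ∷ u′ ∷ L) M (r ∷ p) with split (u′ ∷ L) M p
  ... | p₁ , p₂ = r ∷ p₁ , p₂

  split-before : ∀ {x y c u} L M → Pth x (u ∷ L ++ c ∷ M) y →
                 ∃ λ e → Pth x (u ∷ L) e × R e c ≡ true × Pth c (c ∷ M) y
  split-before [] M (r ∷ p) with refl ← Pth-head p = _ , end _ , r , p
  split-before (u′ ∷ L) M (r ∷ p) with split-before L M p
  ... | e , p₁ , r′ , p₂ = e , r ∷ p₁ , r′ , p₂

  Pth⇒Linked : ∀ {x L y} → Pth x L y → Linked (λ u v → R u v ≡ true) L
  Pth⇒Linked (end _) = [-]
  Pth⇒Linked (r ∷ end _) = r ∷ [-]
  Pth⇒Linked (r ∷ p@(_ ∷ _)) = r ∷ Pth⇒Linked p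

  module _ (R-sym : ∀ u v → R u v ≡ R v u) where

    rev : ∀ {x L y} → Pth x L y → Pth y (reverse L) x
    rev (end x) = end x
    rev {x} (_∷_ {L = L} r p) = subst (λ M → Pth _ M x) (sym (unfold-reverse x L))
      (join (rev p) (trans (R-sym _ x) r) (end x))

    Cycle : ℕ → Set
    Cycle D = ∃₂ λ C s → ∃ λ e → Pth s C e × R e s ≡ true × Unique C × D ≤ length C

    module Crossing {x y : A} (xx : R x x ≡ false) (yy : R y y ≡ false) where

      -- Excludes a crossing when `u` precedes `v`. A crossing yields the cycle that runs from `x`
      -- to `u`, jumps to `y`, goes back to `v` and closes at `x`; it skips just the vertices
      -- between `u` and `v`.
      NA : A → A → Set
      NA u v = R y u ≡ true → R x v ≡ false

      close : ∀ L₁ {u} M {v} L₃ → Pth x ((L₁ ++ u ∷ []) ++ M ++ v ∷ L₃) y →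
              Unique ((L₁ ++ u ∷ []) ++ M ++ v ∷ L₃) → R y u ≡ true → R x v ≡ true →
              ∀ {D} → D ≤ length (L₁ ++ u ∷ []) + length (v ∷ L₃) → Cycle D
      close L₁ {u} M {v} L₃ p un bu av D≤ with Unique-++⁻ (L₁ ++ u ∷ []) un
      ... | u₁ , u′ , dj with Unique-++⁻ M u′
      ... | _ , u₃ , _ = (L₁ ++ u ∷ []) ++ reverse (v ∷ L₃) , x , v ,
          join p₁ (trans (R-sym u y) bu) (rev p₃) , trans (R-sym v x) av ,
          u₁ ++ᵘ Unique-reverse (v ∷ L₃) u₃ [ (λ a b → dj a (∈-++⁺ʳ M (∈-reverse⁻ (v ∷ L₃) b))) ] ,
          ≤-trans D≤ (≤-reflexive (sym (trans (length-++ (L₁ ++ u ∷ []))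
            (cong (length (L₁ ++ u ∷ []) +_) (length-reverse (v ∷ L₃))))))
        where
        p₁ = proj₁ (split L₁ (M ++ v ∷ L₃) (subst (λ L → Pth x L y) (++-assoc L₁ (u ∷ []) (M ++ v ∷ L₃)) p))
        p₃ = proj₂ (split ((L₁ ++ u ∷ []) ++ M) L₃ (subst (λ L → Pth x L y) (sym (++-assoc (L₁ ++ u ∷ []) M (v ∷ L₃))) p))

      scan-adjacent : ∀ L → (∃₂ λ L₁ u → ∃₂ λ v L₃ → L ≡ (L₁ ++ u ∷ []) ++ v ∷ L₃ × R y u ≡ true × R x v ≡ true)
                            ⊎ Linked NA L
      scan-adjacent [] = inj₂ []
      scan-adjacent (u ∷ []) = inj₂ [-]
      scan-adjacent (u ∷ v ∷ L) with scan-adjacent (v ∷ L)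
      ... | inj₁ (L₁ , u′ , v′ , L₃ , e , b , a) = inj₁ (u ∷ L₁ , u′ , v′ , L₃ , cong (u ∷_) e , b , a)
      ... | inj₂ l with R y u in b | R x v in a
      ... | true  | true  = inj₁ ([] , u , v , L , refl , b , a)
      ... | true  | false = inj₂ ((λ _ → a) ∷ l)
      ... | false | _     = inj₂ ((λ t → true≢false t b) ∷ l)

      scan-first : ∀ L → (∃₂ λ M v → ∃ λ L₃ → L ≡ M ++ v ∷ L₃ × R x v ≡ true × All (λ z → R x z ≡ false) M)
                         ⊎ All (λ z → R x z ≡ false) L
      scan-first [] = inj₂ []
      scan-first (v ∷ L) with R x v in a
      ... | true = inj₁ ([] , v , L , refl , a , [])
      ... | false with scan-first L
      ... | inj₁ (M , v′ , L₃ , e , a′ , cl) = inj₁ (v ∷ M , v′ , L₃ , cong (v ∷_) e , a′ , a ∷ cl)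
      ... | inj₂ cl = inj₂ (a ∷ cl)

      -- Suppose the tail has no crossing and its new head `u` is a neighbour of `y`. The first
      -- neighbour `v` of `x` after `u` then gives a shortest crossing: a neighbour of `y` strictly
      -- between them would cross with `v` inside the tail.
      scan-minimal : ∀ L → (∃₂ λ L₁ u → ∃₂ λ M v → ∃ λ L₃ → L ≡ (L₁ ++ u ∷ []) ++ M ++ v ∷ L₃ × R y u ≡ true ×
                              R x v ≡ true × All (λ z → R x z ≡ false × R y z ≡ false) M)
                           ⊎ AllPairs NA L
      scan-minimal [] = inj₂ []
      scan-minimal (u ∷ L) with scan-minimal L
      ... | inj₁ (L₁ , u′ , M , v , L₃ , e , rest) = inj₁ (u ∷ L₁ , u′ , M , v , L₃ , cong (u ∷_) e , rest)
      ... | inj₂ ap with R y u in b | scan-first L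
      ... | false | _ = inj₂ (All.tabulate (λ _ t → true≢false t b) ∷ ap)
      ... | true | inj₂ cl = inj₂ (All.map (λ a _ → a) cl ∷ ap)
      ... | true | inj₁ (M , v , L₃ , refl , a , cl) = inj₁ ([] , u , M , v , L₃ , refl , b , a ,
              All.tabulate λ z∈ → All.lookup cl z∈ ,
                ≢true⇒false λ t → true≢false a (AllPairs-++⁻ M ap z∈ (here refl) t))

      -- A step from `u` to `v` along the path carries at most one of `y ~ u` and `x ~ v`. The last
      -- vertex has no step after it, whence the extra 1.
      count-prefix : ∀ u L → Linked NA (u ∷ L) → count (u ∷ L) (R y) + count L (R x) ≤ suc (length L)
      count-prefix u [] _ = ≤-trans (≤-reflexive (+-identityʳ _)) (count-≤-length (R y) (u ∷ []))
      count-prefix u (v ∷ L) (na ∷ l) with R y u | R x v | na | count-prefix v L l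
      ... | true  | true  | na | _ = contradiction (na refl) λ ()
      ... | true  | false | _ | ih = s≤s ih
      ... | false | true  | _ | ih = ≤-trans (≤-reflexive (+-suc (count (v ∷ L) (R y)) (count L (R x)))) (s≤s ih)
      ... | false | false | _ | ih = m≤n⇒m≤1+n ih

      -- Here the last vertex is `y`, which is not its own neighbour, so the extra 1 of
      -- `count-prefix` disappears.
      count-suffix : ∀ u L → Pth u (u ∷ L) y → Linked NA (u ∷ L) → count (u ∷ L) (R y) + count L (R x) ≤ length L
      count-suffix u [] (end _) _ = ≤-reflexive (trans (+-identityʳ _) (count-∷-false (R y) [] yy))
      count-suffix u (v ∷ L) (_ ∷ p) (na ∷ l) with refl ← Pth-head p
        with R y u | R x v | na | count-suffix v L p l
      ... | true  | true  | na | _ = contradiction (na refl) λ ()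
      ... | true  | false | _ | ih = s≤s ih
      ... | false | true  | _ | ih = ≤-trans (≤-reflexive (+-suc (count (v ∷ L) (R y)) (count L (R x)))) (s≤s ih)
      ... | false | false | _ | ih = m≤n⇒m≤1+n ih

      -- Pósa's argument: the vertices outside a shortest crossing number at least the neighbours of x and of y together.
      crossing : ∀ {L D} → Pth x L y → Unique L → D ≤ length L → D ≤ count L (R x) + count L (R y) →
                 Cycle D ⊎ AllPairs NA L
      crossing {L} {D} p un D≤L D≤ with scan-adjacent L
      -- A crossing of consecutive vertices skips nothing: the cycle contains the whole path.
      ... | inj₁ (L₁ , u , v , L₃ , refl , b , a) = inj₁ (close L₁ [] L₃ p un b a (≤-trans D≤L (≤-reflexive (length-++ (L₁ ++ u ∷ [])))))
      ... | inj₂ linked with scan-minimal L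
      ... | inj₂ ap = inj₂ ap
      ... | inj₁ (L₁ , u , M , v , L₃ , refl , b , a , clear) = inj₁ (close L₁ M L₃ p un b a bound)
        where
        open ≤-Reasoning
        P = L₁ ++ u ∷ []
        S = v ∷ L₃
        lkP = proj₁ (Linked-++⁻ P linked)
        lkS = proj₂ (Linked-++⁻ M (proj₂ (Linked-++⁻ P linked)))
        count-total : ∀ f → All (λ z → f z ≡ false) M → count (P ++ M ++ S) f ≡ count P f + count S f
        count-total f cl = trans (count-++ f P (M ++ S)) (cong (count P f +_)
          (trans (count-++ f M S) (cong (_+ count S f) (count-none f cl))))
        start-bound : ∀ W {e} → Pth x W e → Linked NA W → count W (R x) + count W (R y) ≤ length W
        start-bound (w ∷ W) q lk with refl ← Pth-head q =
          ≤-trans (≤-reflexive (trans (+-comm (count (x ∷ W) (R x)) _) (cong (count (x ∷ W) (R y) +_) (count-∷-false (R x) W xx))))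
                  (count-prefix x W lk)
        P-bound : count P (R x) + count P (R y) ≤ length P
        P-bound = start-bound P (proj₁ (split L₁ (M ++ S) (subst (λ L → Pth x L y) (++-assoc L₁ (u ∷ []) (M ++ S)) p))) lkP
        -- `v` is a neighbour of `x` and has no predecessor in `S`; the unit saved at `y` pays for
        -- it.
        S-bound : count S (R x) + count S (R y) ≤ length S
        S-bound = ≤-trans (≤-reflexive (trans (cong (_+ count S (R y)) (count-∷-true (R x) L₃ a)) (cong suc (+-comm (count L₃ (R x)) _))))
          (s≤s (count-suffix v L₃ (proj₂ (split (P ++ M) L₃ (subst (λ L → Pth x L y) (sym (++-assoc P M S)) p))) lkS))
        rearrange : ∀ a b c d → (a + b) + (c + d) ≡ (a + c) + (b + d)
        rearrange = solve 4 (λ a b c d → (a :+ b) :+ (c :+ d) := (a :+ c) :+ (b :+ d)) refl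
          where open +-*-Solver
        bound : D ≤ length P + length S
        bound = begin
          D                                                                      ≤⟨ D≤ ⟩
          count (P ++ M ++ S) (R x) + count (P ++ M ++ S) (R y)                  ≡⟨ cong₂ _+_ (count-total (R x) (All.map proj₁ clear)) (count-total (R y) (All.map proj₂ clear)) ⟩
          (count P (R x) + count S (R x)) + (count P (R y) + count S (R y))      ≡⟨ rearrange (count P (R x)) (count S (R x)) (count P (R y)) (count S (R y)) ⟩
          (count P (R x) + count P (R y)) + (count S (R x) + count S (R y))      ≤⟨ +-mono-≤ P-bound S-bound ⟩
          length P + length S                                                    ∎

    rotate : ∀ {s e c} E₁ E₂ → Pth s (E₁ ++ c ∷ E₂) e → R e s ≡ true → ∃ λ f → Pth c ((c ∷ E₂) ++ E₁) f
    rotate {s} {e} [] E₂ p r with refl ← Pth-head p = e , subst (λ L → Pth s L e) (sym (++-identityʳ (s ∷ E₂))) p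
    rotate (v ∷ E₁) E₂ p r with split-before E₁ E₂ p
    ... | f , p₁ , _ , p₂ = f , join p₂ r p₁

    Unique-rotate : ∀ (E₁ : List A) {E₂} → Unique (E₁ ++ E₂) → Unique (E₂ ++ E₁)
    Unique-rotate E₁ u = let u₁ , u₂ , dj = Unique-++⁻ E₁ u in u₂ ++ᵘ u₁ [ (λ a b → dj b a) ]

    length-rotate : ∀ (E₁ E₂ : List A) → length (E₁ ++ E₂) ≡ length (E₂ ++ E₁)
    length-rotate E₁ E₂ = trans (length-++ E₁) (trans (+-comm (length E₁) _) (sym (length-++ E₂)))

    -- A path starting at x with d neighbours of x on it can be rerouted so as to start at any prescribed
    -- vertex of the path and still contain the cycle closed by the last neighbour of x.
    reroute : ∀ {x L y c} → R x x ≡ false → Pth x L y → Unique L → c ∈ L →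
              ∃₂ λ L′ e → Pth c L′ e × Unique L′ × (∀ {z} → z ∈ L′ → z ∈ L) × suc (count L (R x)) ≤ length L′
    reroute {x} {L} {y} {c} xx p un c∈ = go L p un c∈ (last-nbr L)
      where
      LastNbr : List A → Set
      LastNbr L = (∃₂ λ L₁ d → ∃ λ L₂ → L ≡ L₁ ++ d ∷ L₂ × R x d ≡ true × count L (R x) ≤ count (L₁ ++ d ∷ []) (R x))
                  ⊎ count L (R x) ≡ 0
      Rerouted : List A → Set
      Rerouted L = ∃₂ λ L′ e → Pth c L′ e × Unique L′ × (∀ {z} → z ∈ L′ → z ∈ L) × suc (count L (R x)) ≤ length L′
      last-nbr : ∀ L → LastNbr L
      last-nbr [] = inj₂ refl
      last-nbr (v ∷ L) with last-nbr L
      ... | inj₁ (L₁ , d , L₂ , refl , r , le) = inj₁ (v ∷ L₁ , d , L₂ , refl , r , mono)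
        where
        mono : count (v ∷ L₁ ++ d ∷ L₂) (R x) ≤ count (v ∷ L₁ ++ d ∷ []) (R x)
        mono with R x v
        ... | true  = s≤s le
        ... | false = le
      ... | inj₂ c0 with R x v in r
      ... | true = inj₁ ([] , v , L , refl , r , ≤-trans (≤-reflexive (cong suc c0)) (≤-reflexive (sym (count-∷-true (R x) [] r))))
      ... | false = inj₂ c0
      go : ∀ L → Pth x L y → Unique L → c ∈ L → LastNbr L → Rerouted L
      -- Without neighbours of `x` on the path, `c` alone is long enough.
      go L p un c∈ (inj₂ c0) = c ∷ [] , c , end c , [] ∷ [] , (λ { (here refl) → c∈ }) , s≤s (≤-reflexive c0)
      go _ p un c∈ (inj₁ ([] , d , L₂ , refl , r , le)) with refl ← Pth-head p = true≢false r xx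
      go _ p un c∈ (inj₁ (v ∷ L₁ , d , L₂ , refl , r , le)) with refl ← Pth-head p = body
        where
        cyc = x ∷ L₁ ++ d ∷ []
        assoc : x ∷ L₁ ++ d ∷ L₂ ≡ cyc ++ L₂
        assoc = cong (x ∷_) (sym (++-assoc L₁ (d ∷ []) L₂))
        pB : Pth x cyc d
        pB = proj₁ (split (x ∷ L₁) L₂ p)
        uB : Unique cyc
        uB = proj₁ (Unique-++⁻ cyc (subst Unique assoc un))
        sub : ∀ {z} → z ∈ cyc → z ∈ x ∷ L₁ ++ d ∷ L₂
        sub {z} z∈ = subst (z ∈_) (sym assoc) (∈-++⁺ˡ z∈)
        long : suc (count (x ∷ L₁ ++ d ∷ L₂) (R x)) ≤ length cyc
        long = s≤s (≤-trans le (≤-trans (≤-reflexive (count-∷-false (R x) (L₁ ++ d ∷ []) xx)) (count-≤-length (R x) (L₁ ++ d ∷ []))))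
        Goal = Rerouted (x ∷ L₁ ++ d ∷ L₂)
        inside : ∀ E₁ E₂ → cyc ≡ E₁ ++ c ∷ E₂ → Goal
        inside E₁ E₂ e = let f , q = rotate E₁ E₂ (subst (λ L → Pth x L d) e pB) (trans (R-sym d x) r) in
          (c ∷ E₂) ++ E₁ , f , q , Unique-rotate E₁ (subst Unique e uB) ,
          (λ {z} z∈ → sub (subst (z ∈_) (sym e) ([ ∈-++⁺ʳ E₁ , ∈-++⁺ˡ ]′ (∈-++⁻ (c ∷ E₂) z∈)))) ,
          ≤-trans long (≤-reflexive (trans (cong length e) (length-rotate E₁ (c ∷ E₂))))
        body : Goal
        body with ∈-++⁻ cyc (subst (c ∈_) assoc c∈)
        ... | inj₁ c∈cyc with ∈-∃++ c∈cyc
        ...   | E₁ , E₂ , e = inside E₁ E₂ e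
        -- If `c` lies beyond the cycle, the way back from `c` to `x` passes through all of it.
        body | inj₂ c∈L₂ with ∈-∃++ c∈L₂
        ...   | E₁ , E₂ , refl =
          reverse ((cyc ++ E₁) ++ c ∷ []) , x , rev (proj₁ (split (cyc ++ E₁) E₂ (subst (λ L → Pth x L y) assoc′ p))) ,
          Unique-reverse ((cyc ++ E₁) ++ c ∷ []) (proj₁ (Unique-++⁻ ((cyc ++ E₁) ++ c ∷ []) (subst Unique (trans assoc′ (sym (++-assoc (cyc ++ E₁) (c ∷ []) E₂))) un))) ,
          (λ {z} z∈ → subst (z ∈_) (sym (trans assoc′ (sym (++-assoc (cyc ++ E₁) (c ∷ []) E₂)))) (∈-++⁺ˡ (∈-reverse⁻ ((cyc ++ E₁) ++ c ∷ []) z∈))) ,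
          ≤-trans long (≤-trans (m≤m+n (length cyc) (length E₁ + 1)) (≤-reflexive
            (sym (trans (length-reverse ((cyc ++ E₁) ++ c ∷ [])) (trans (length-++ (cyc ++ E₁)) (trans (cong (_+ 1) (length-++ cyc)) (+-assoc (length cyc) (length E₁) 1)))))))
          where
          assoc′ : x ∷ L₁ ++ d ∷ E₁ ++ c ∷ E₂ ≡ (cyc ++ E₁) ++ c ∷ E₂
          assoc′ = trans assoc (sym (++-assoc cyc E₁ (c ∷ E₂)))

open Path using (Pth; end; _∷_)

-- Kopylov's argument

Long : ∀ {n} → Graph n → ℕ → Set
Long G p = ∃₂ λ L x → ∃ λ y → Pth (adj G) x L y × Unique L × p < length L

record TwoPaths {n} (G : Graph n) (p : ℕ) (x y : Fin n) : Set where
  field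
    {P Q} : List (Fin n)
    {e f} : Fin n
    pathˣ : Pth (adj G) x P e
    pathʸ : Pth (adj G) y Q f
    uniqueˣ : Unique P
    uniqueʸ : Unique Q
    disjoint : Disjoint P Q
    long : p < length P + length Q

-- The form in which edge-maximality is used: a long path created by the edge `x y` runs through it,
-- and deleting the edge leaves two disjoint paths ending in `x` and `y`.
Saturated : ∀ {n} → Graph n → ℕ → Set
Saturated G p = ∀ x y → x ≢ y → adj G x y ≡ false → TwoPaths G p x y

-- The universal vertex nothing joins a pair of disjoint paths into one path.
module Apex {n} (G : Graph n) where

  adj⁺ : Maybe (Fin n) → Maybe (Fin n) → Bool
  adj⁺ nothing  nothing  = false
  adj⁺ nothing  (just _) = true
  adj⁺ (just _) nothing  = true
  adj⁺ (just u) (just v) = adj G u v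

  adj⁺-sym : ∀ u v → adj⁺ u v ≡ adj⁺ v u
  adj⁺-sym nothing  nothing  = refl
  adj⁺-sym nothing  (just _) = refl
  adj⁺-sym (just _) nothing  = refl
  adj⁺-sym (just u) (just v) = adj-sym G u v

  lift : ∀ {x L y} → Pth (adj G) x L y → Pth adj⁺ (just x) (map just L) (just y)
  lift (end x) = end (just x)
  lift (r ∷ p) = r ∷ lift p

  unlift : ∀ {x L y} → Pth adj⁺ x L y → nothing ∉ L → ∃₂ λ M u → ∃ λ v → map just M ≡ L × x ≡ just u × Pth (adj G) u M v
  unlift (end nothing) ∉L = contradiction (here refl) ∉L
  unlift (end (just x)) _ = x ∷ [] , x , x , refl , refl , end x
  unlift {nothing} (r ∷ p) ∉L = contradiction (here refl) ∉L
  unlift {just x} (r ∷ p) ∉L with unlift p (∉L ∘ there)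
  ... | M , u , v , refl , refl , q = x ∷ M , x , v , refl , refl , r ∷ q

  unlift-Long : ∀ {p x L y} → Pth adj⁺ x L y → nothing ∉ L → Unique L → p < length L → Long G p
  unlift-Long q ∉L u p< with unlift q ∉L
  ... | M , a , b , refl , _ , q′ = M , a , b , q′ , Unique-map⁻ u , ≤-trans p< (≤-reflexive (length-map just M))

  cycle⇒Long : ∀ {p} → Path.Cycle adj⁺ adj⁺-sym (2 + p) → Long G p
  cycle⇒Long (C , s , e , q , r , u , len) with DecMembership._∈?_ (Maybe-≡-dec _≟_) nothing C
  ... | no ∉C = unlift-Long q ∉C u (<⇒≤ len)
  ... | yes ∈C with ∈-∃++ ∈C
  ... | E₁ , E₂ , refl with Path.rotate adj⁺ adj⁺-sym E₁ E₂ q r | Path.Unique-rotate adj⁺ adj⁺-sym E₁ u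
  ... | f , q′ | u′ = tail (E₂ ++ E₁) q′ u′ (≤-trans len (≤-reflexive (Path.length-rotate adj⁺ adj⁺-sym E₁ (nothing ∷ E₂))))
    where
    tail : ∀ {p} M {f} → Pth adj⁺ nothing (nothing ∷ M) f → Unique (nothing ∷ M) → 2 + p ≤ suc (length M) → Long G p
    tail [] _ _ (s≤s ())
    tail (v ∷ M) (_ ∷ q) u@(_ ∷ u′) len = unlift-Long q (Unique-head u) u′ (≤-pred len)

module Kopylov {n} (G : Graph n) {p} (conn : Connected G) (short : ¬ Long G p) where

  open Apex G
  open DecMembership (_≟_ {n}) using (_∈?_)

  -- A walk from `x` to `y` is followed until it meets `Q`. Rerouting `P` and `Q` to begin where the
  -- link attaches keeps more than `a` vertices of `P` and more than `b` of `Q`, hence more than `p`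
  -- in all.
  bridge : ∀ {x y P e Q f a b} → Pth (adj G) x P e → Pth (adj G) y Q f → Unique P → Unique Q → Disjoint P Q →
           a ≤ count P (adj G x) → b ≤ count Q (adj G y) → p ≤ a + b → ⊥
  bridge {x} {y} {P} {e} {Q} {f} {a} {b} pP pQ uP uQ dj a≤ b≤ p≤ =
    walk (start (Path.Pth-start (adj G) pP)) (λ x∈Q → dj (Path.Pth-start (adj G) pP) x∈Q) (conn x y)
    where
    -- A path from the current vertex of the walk: a link `I` off both `P` and `Q`, followed by a
    -- rerouted piece `P′` of `P`. The link is discarded when the walk returns to `P`, and cut short
    -- when the walk returns to the link.
    record Tentacle (v : Fin n) : Set where
      field
        {I P′} : List (Fin n)
        {w} : Fin n
        path : Pth (adj G) v (I ++ P′) w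
        uniq : Unique (I ++ P′)
        sub  : ∀ {z} → z ∈ P′ → z ∈ P
        I∩P  : Disjoint I P
        I∩Q  : Disjoint I Q
        size : a < length P′
    start : ∀ {v} → v ∈ P → Tentacle v
    start v∈ with Path.reroute (adj G) (adj-sym G) (irrefl G x) pP uP v∈
    ... | P′ , w , path , uniq , sub , size = record
      { I = [] ; path = path ; uniq = uniq ; sub = sub ; I∩P = λ () ; I∩Q = λ () ; size = ≤-trans (s≤s a≤) size }
    walk : ∀ {v} → Tentacle v → v ∉ Q → Walk G v y → ⊥
    walk t v∉ here = v∉ (Path.Pth-start (adj G) pQ)
    walk {v} t v∉ (step {v = v′} r ws) with v′ ∈? Q
    ... | yes v′∈Q with Path.reroute (adj G) (adj-sym G) (irrefl G y) pQ uQ v′∈Q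
    ... | Q′ , w′ , pathQ , uniqQ , subQ , sizeQ = short
      (reverse (I ++ P′) ++ Q′ , w , w′ , Path.join (adj G) (Path.rev (adj G) (adj-sym G) path) r pathQ ,
       Unique-reverse (I ++ P′) uniq ++ᵘ uniqQ [ dj′ ] , size′)
      where
      open Tentacle t
      open ≤-Reasoning
      dj′ : Disjoint (reverse (I ++ P′)) Q′
      dj′ z∈ z∈Q′ with ∈-++⁻ I (∈-reverse⁻ (I ++ P′) z∈)
      ... | inj₁ z∈I = I∩Q z∈I (subQ z∈Q′)
      ... | inj₂ z∈P′ = dj (sub z∈P′) (subQ z∈Q′)
      size′ : p < length (reverse (I ++ P′) ++ Q′)
      size′ = begin-strict
        p                                          ≤⟨ p≤ ⟩
        a + b                                      <⟨ +-mono-<-≤ size (≤-trans b≤ (<⇒≤ sizeQ)) ⟩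
        length P′ + length Q′                      ≤⟨ +-monoˡ-≤ (length Q′) (m≤n+m (length P′) (length I)) ⟩
        length I + length P′ + length Q′           ≡⟨ cong (_+ length Q′) (trans (length-reverse (I ++ P′)) (length-++ I)) ⟨
        length (reverse (I ++ P′)) + length Q′     ≡⟨ length-++ (reverse (I ++ P′)) ⟨
        length (reverse (I ++ P′) ++ Q′)           ∎
    walk {v} t v∉ (step {v = v′} r ws) | no v′∉Q with v′ ∈? P
    ... | yes v′∈P = walk (start v′∈P) v′∉Q ws
    ... | no v′∉P with v′ ∈? Tentacle.I t
    ... | yes v′∈I = walk (shorten (∈-∃++ v′∈I)) v′∉Q ws
      where
      open Tentacle t
      shorten : (∃₂ λ I₁ I₂ → I ≡ I₁ ++ v′ ∷ I₂) → Tentacle v′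
      shorten (I₁ , I₂ , e) = record
        { I = v′ ∷ I₂ ; P′ = P′
        ; path = proj₂ (Path.split (adj G) I₁ (I₂ ++ P′) (subst (λ L → Pth (adj G) v L w) eq path))
        ; uniq = proj₁ (proj₂ (Unique-++⁻ I₁ (subst Unique eq uniq)))
        ; sub = sub
        ; I∩P = λ {z} z∈ → I∩P (subst (z ∈_) (sym e) (∈-++⁺ʳ I₁ z∈))
        ; I∩Q = λ {z} z∈ → I∩Q (subst (z ∈_) (sym e) (∈-++⁺ʳ I₁ z∈))
        ; size = size }
        where
        eq : I ++ P′ ≡ I₁ ++ (v′ ∷ I₂) ++ P′
        eq = trans (cong (_++ P′) e) (++-assoc I₁ (v′ ∷ I₂) P′)
    ... | no v′∉I = walk (record
        { I = v′ ∷ I ; P′ = P′ ; path = trans (adj-sym G v′ v) r ∷ path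
        ; uniq = ∉⇒All≢ ([ v′∉I , v′∉P ∘ sub ]′ ∘ ∈-++⁻ I) ∷ uniq
        ; sub = sub
        ; I∩P = λ { (here refl) → v′∉P ; (there z∈) → I∩P z∈ }
        ; I∩Q = λ { (here refl) → v′∉Q ; (there z∈) → I∩Q z∈ }
        ; size = size }) v′∉Q ws
      where open Tentacle t

  Disjoint-map : {P Q : List (Fin n)} → Disjoint P Q → Disjoint (map just P) (nothing ∷ reverse (map just Q))
  Disjoint-map dj z∈P (here refl) with ∈-map⁻ just z∈P
  ... | _ , _ , ()
  Disjoint-map {Q = Q} dj z∈P (there z∈Q) with ∈-map⁻ just z∈P | ∈-map⁻ just (∈-reverse⁻ (map just Q) z∈Q)
  ... | u , u∈ , refl | v , v∈ , e = dj u∈ (subst (_∈ Q) (sym (just-injective e)) v∈)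

  nothing∉ : ∀ {Q : List (Fin n)} → nothing ∉ reverse (map just Q)
  nothing∉ {Q} ∈Q with ∈-map⁻ just (∈-reverse⁻ (map just Q) ∈Q)
  ... | _ , _ , ()

  enclosed : ∀ {x y a b} (t : TwoPaths G p x y) → let open TwoPaths t in
             a ≤ count (P ++ Q) (adj G x) → b ≤ count (P ++ Q) (adj G y) → p ≤ a + b → ⊥
  enclosed {x} {y} {a} {b} t a≤ b≤ p≤ = [ short ∘ cycle⇒Long , separated ]′
    (Path.Crossing.crossing adj⁺ adj⁺-sym {just x} {just y} (irrefl G x) (irrefl G y) path⁺ unique⁺ length⁺ bound⁺)
    where
    open TwoPaths t
    open ≤-Reasoning
    L⁺ = map just P ++ nothing ∷ reverse (map just Q)
    path⁺ : Pth adj⁺ (just x) L⁺ (just y)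
    path⁺ = Path.join adj⁺ (lift pathˣ) refl (refl ∷ Path.rev adj⁺ adj⁺-sym (lift pathʸ))
    unique⁺ : Unique L⁺
    unique⁺ = Unique-map⁺ just-injective uniqueˣ
      ++ᵘ ∉⇒All≢ (nothing∉ {Q}) ∷ Unique-reverse (map just Q) (Unique-map⁺ just-injective uniqueʸ) [ Disjoint-map {P} {Q} disjoint ]
    length⁺ : 2 + p ≤ length L⁺
    length⁺ = begin
      2 + p                                                   ≤⟨ s≤s long ⟩
      suc (length P + length Q)                               ≡⟨ +-suc (length P) (length Q) ⟨
      length P + suc (length Q)                               ≡⟨ cong₂ (λ a b → a + suc b) (length-map just P) (trans (length-reverse (map just Q)) (length-map just Q)) ⟨
      length (map just P) + suc (length (reverse (map just Q))) ≡⟨ length-++ (map just P) ⟨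
      length L⁺                                               ∎
    count⁺ : ∀ v → count L⁺ (adj⁺ (just v)) ≡ suc (count (P ++ Q) (adj G v))
    count⁺ v = begin-equality
      count L⁺ (adj⁺ (just v))                                        ≡⟨ count-++ (adj⁺ (just v)) (map just P) _ ⟩
      count (map just P) (adj⁺ (just v)) + suc (count (reverse (map just Q)) (adj⁺ (just v)))
        ≡⟨ cong₂ (λ a b → a + suc b) (count-map just _ P) (trans (count-reverse _ (map just Q)) (count-map just _ Q)) ⟩
      count P (adj G v) + suc (count Q (adj G v))                     ≡⟨ +-suc (count P (adj G v)) _ ⟩
      suc (count P (adj G v) + count Q (adj G v))                     ≡⟨ cong suc (count-++ (adj G v) P Q) ⟨
      suc (count (P ++ Q) (adj G v))                                  ∎
    -- Each end gains the neighbour `nothing`, which accounts for the 2.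
    bound⁺ : 2 + p ≤ count L⁺ (adj⁺ (just x)) + count L⁺ (adj⁺ (just y))
    bound⁺ = begin
      2 + p                       ≤⟨ s≤s (s≤s p≤) ⟩
      2 + (a + b)                 ≡⟨ cong suc (+-suc a b) ⟨
      suc a + suc b               ≤⟨ +-mono-≤ (s≤s a≤) (s≤s b≤) ⟩
      suc (count (P ++ Q) (adj G x)) + suc (count (P ++ Q) (adj G y)) ≡⟨ cong₂ _+_ (count⁺ x) (count⁺ y) ⟨
      count L⁺ (adj⁺ (just x)) + count L⁺ (adj⁺ (just y)) ∎
    -- Comparison with `nothing`, adjacent to both ends: as a neighbour of `y` it keeps the
    -- neighbours of `x` out of `Q`, and as a neighbour of `x` it keeps those of `y` out of `P`.
    separated : AllPairs (λ u v → adj⁺ (just y) u ≡ true → adj⁺ (just x) v ≡ false) L⁺ → ⊥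
    separated ap = bridge pathˣ pathʸ uniqueˣ uniqueʸ disjoint (≤-trans a≤ (≤-reflexive cx)) (≤-trans b≤ (≤-reflexive cy)) p≤
      where
      ap′ = subst (AllPairs _) (sym (++-assoc (map just P) (nothing ∷ []) (reverse (map just Q)))) ap
      noQ : All (λ v → adj G x v ≡ false) Q
      noQ = All.tabulate λ v∈ → AllPairs-++⁻ (map just P ++ nothing ∷ []) ap′
              (∈-++⁺ʳ (map just P) (here refl)) (reverse⁺ (∈-map⁺ just v∈)) refl
      noP : All (λ v → adj G y v ≡ false) P
      noP = All.tabulate λ v∈ → ≢true⇒false λ h →
              contradiction (AllPairs-++⁻ (map just P) ap (∈-map⁺ just v∈) (here refl) h) λ ()
      cx : count (P ++ Q) (adj G x) ≡ count P (adj G x)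
      cx = trans (count-++ (adj G x) P Q) (trans (cong (count P (adj G x) +_) (count-none (adj G x) noQ)) (+-identityʳ _))
      cy : count (P ++ Q) (adj G y) ≡ count Q (adj G y)
      cy = trans (count-++ (adj G y) P Q) (cong (_+ count Q (adj G y)) (count-none (adj G y) noP))

  module _ (A B : Fin n → Bool) {a b}
           (A-deg : ∀ {v} → A v ≡ true → a ≤ countᶠ (λ u → A u ∧ adj G v u))
           (B-deg : ∀ {v} → B v ≡ true → b ≤ countᶠ (λ u → B u ∧ adj G v u))
           (p≤ : p ≤ a + b) where

    escapes : (C : Fin n → Bool) (v : Fin n) (P Q : List (Fin n)) →
              Dec (∃ λ z → (C z ≡ true × adj G v z ≡ true) × z ∉ P × z ∉ Q)
    escapes C v P Q = any? λ z → ((C z Bool.≟ true) ×-dec (adj G v z Bool.≟ true)) ×-dec (¬? (z ∈? P) ×-dec ¬? (z ∈? Q))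

    trapped : (C : Fin n → Bool) (v : Fin n) (P Q : List (Fin n)) →
              ¬ (∃ λ z → (C z ≡ true × adj G v z ≡ true) × z ∉ P × z ∉ Q) →
              countᶠ (λ u → C u ∧ adj G v u) ≤ count (P ++ Q) (adj G v)
    trapped C v P Q none = ≤-trans (countᶠ-≤-list cover) (count-mono (λ {u} h → proj₂ (∧-elim {C u} h)) (P ++ Q))
      where
      cover : ∀ {z} → C z ∧ adj G v z ≡ true → z ∈ P ++ Q
      cover {z} h with z ∈? P | z ∈? Q
      ... | yes z∈ | _ = ∈-++⁺ˡ z∈
      ... | no _ | yes z∈ = ∈-++⁺ʳ P z∈
      ... | no z∉P | no z∉Q = contradiction (z , ∧-elim h , z∉P , z∉Q) none

    -- Extend the pair of paths through neighbours in A and B until all those neighbours lie on the paths.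
    grow : ∀ fuel {x y} → A x ≡ true → B y ≡ true → adj G x y ≡ false → (t : TwoPaths G p x y) →
           n < fuel + (length (TwoPaths.P t) + length (TwoPaths.Q t)) → ⊥
    grow zero Ax By xy t n< = <⇒≱ n< (≤-trans (≤-reflexive (sym (length-++ P)))
      (≤-trans (Unique-length-≤ (uniqueˣ ++ᵘ uniqueʸ [ disjoint ]) (λ _ → ∈-allFin _)) (≤-reflexive (length-tabulate id))))
      where open TwoPaths t
    grow (suc fuel) {x} {y} Ax By xy t n< with escapes A x (TwoPaths.P t) (TwoPaths.Q t)
    ... | yes (z , (Az , xz) , z∉P , z∉Q) with adj G z y in zy
    -- If `z` is adjacent to `y`, it joins both paths into one that is too long. Otherwise `z`
    -- replaces `x` as an end, and the pair remains non-adjacent.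
    ... | true = short (reverse (z ∷ P) ++ Q , e , f ,
            Path.join (adj G) (Path.rev (adj G) (adj-sym G) (trans (adj-sym G z x) xz ∷ pathˣ)) zy pathʸ ,
            Unique-reverse (z ∷ P) (∉⇒All≢ z∉P ∷ uniqueˣ) ++ᵘ uniqueʸ [ (λ a b → dj (∈-reverse⁻ (z ∷ P) a) b) ] ,
            <-≤-trans (m<n⇒m<1+n long) (≤-reflexive (sym (trans (length-++ (reverse (z ∷ P))) (cong (_+ length Q) (length-reverse (z ∷ P)))))))
      where
      open TwoPaths t
      dj : Disjoint (z ∷ P) Q
      dj (here refl) = z∉Q
      dj (there a) = disjoint a
    ... | false = grow fuel Az By zy record
            { pathˣ = trans (adj-sym G z x) xz ∷ pathˣ ; pathʸ = pathʸ
            ; uniqueˣ = ∉⇒All≢ z∉P ∷ uniqueˣ ; uniqueʸ = uniqueʸ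
            ; disjoint = λ { (here refl) → z∉Q ; (there a) → disjoint a }
            ; long = m<n⇒m<1+n long }
            (≤-trans n< (≤-reflexive (sym (+-suc fuel _))))
      where open TwoPaths t
    grow (suc fuel) {x} {y} Ax By xy t n< | no A-none with escapes B y (TwoPaths.P t) (TwoPaths.Q t)
    ... | no B-none = enclosed t (≤-trans (A-deg Ax) (trapped A x P Q A-none)) (≤-trans (B-deg By) (trapped B y P Q B-none)) p≤
      where open TwoPaths t
    ... | yes (z , (Bz , yz) , z∉P , z∉Q) with adj G x z in xz
    ... | true = short (reverse P ++ z ∷ Q , e , f ,
            Path.join (adj G) (Path.rev (adj G) (adj-sym G) pathˣ) xz (trans (adj-sym G z y) yz ∷ pathʸ) ,
            Unique-reverse P uniqueˣ ++ᵘ ∉⇒All≢ z∉Q ∷ uniqueʸ [ (λ a b → dj (∈-reverse⁻ P a) b) ] ,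
            <-≤-trans (m<n⇒m<1+n long) (≤-reflexive (trans (sym (+-suc (length P) (length Q)))
              (sym (trans (length-++ (reverse P)) (cong (_+ suc (length Q)) (length-reverse P)))))))
      where
      open TwoPaths t
      dj : Disjoint P (z ∷ Q)
      dj a (here refl) = z∉P a
      dj a (there b) = disjoint a b
    ... | false = grow fuel Ax Bz xz record
            { pathˣ = pathˣ ; pathʸ = trans (adj-sym G z y) yz ∷ pathʸ
            ; uniqueˣ = uniqueˣ ; uniqueʸ = ∉⇒All≢ z∉Q ∷ uniqueʸ
            ; disjoint = λ { a (here refl) → z∉P a ; a (there b) → disjoint a b }
            ; long = ≤-trans (m<n⇒m<1+n long) (≤-reflexive (sym (+-suc (length P) (length Q)))) }
            (≤-trans n< (≤-reflexive (trans (sym (+-suc fuel _)) (cong (fuel +_) (sym (+-suc (length P) (length Q)))))))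
      where open TwoPaths t

    -- `A` and `B` may coincide, which makes a single core a clique, or differ, which compares a
    -- core with a maximal clique. The fuel `suc n` suffices because disjoint paths occupy at most
    -- `n` vertices.
    adjacent : Saturated G p → ∀ {x y} → A x ≡ true → B y ≡ true → x ≢ y → adj G x y ≡ true
    adjacent sat {x} {y} Ax By x≢y with adj G x y in xy
    ... | true = refl
    ... | false = contradiction (m≤m+n (suc n) _) (grow (suc n) Ax By xy (sat x y x≢y xy))

open Path using (Pth; end; _∷_)

-- Saturation and cores

∨-elim : ∀ {a b} → a ∨ b ≡ true → a ≡ true ⊎ b ≡ true
∨-elim {true}  _ = inj₁ refl
∨-elim {false} e = inj₂ e

_⊑_ : ∀ {n} → Graph n → Graph n → Set
G ⊑ G′ = ∀ {i j} → adj G i j ≡ true → adj G′ i j ≡ true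

module _ {n} (G : Graph n) {x y : Fin n} (x≢y : x ≢ y) where

  addEdge : Graph n
  addEdge = record
    { adj = λ u v → adj G u v ∨ (((u =ᶠ x) ∧ (v =ᶠ y)) ∨ ((u =ᶠ y) ∧ (v =ᶠ x)))
    ; sym = λ u v → cong₂ _∨_ (adj-sym G u v)
        (trans (∨-comm _ ((u =ᶠ y) ∧ (v =ᶠ x))) (cong₂ _∨_ (∧-comm (u =ᶠ y) _) (∧-comm (u =ᶠ x) _)))
    ; irrefl = λ v → ≢true⇒false λ h → [ (λ a → true≢false a (irrefl G v)) ,
        ([ (λ e → let a , b = ∧-elim {v =ᶠ x} e in x≢y (trans (sym (=ᶠ-elim a)) (=ᶠ-elim b))) ,
           (λ e → let a , b = ∧-elim {v =ᶠ y} e in x≢y (trans (sym (=ᶠ-elim b)) (=ᶠ-elim a))) ]′ ∘ ∨-elim) ]′ (∨-elim h)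
    }

  ⊑-addEdge : G ⊑ addEdge
  ⊑-addEdge e rewrite e = refl

  addEdge-xy : adj addEdge x y ≡ true
  addEdge-xy rewrite =ᶠ-intro {i = x} refl | =ᶠ-intro {i = y} refl = ∨-zeroʳ _

  addEdge-elim : ∀ {u v} → adj addEdge u v ≡ true → adj G u v ≡ true ⊎ (u ≡ x × v ≡ y) ⊎ (u ≡ y × v ≡ x)
  addEdge-elim {u} h with ∨-elim h
  ... | inj₁ a = inj₁ a
  ... | inj₂ h′ with ∨-elim h′
  ... | inj₁ e = let a , b = ∧-elim {u =ᶠ x} e in inj₂ (inj₁ (=ᶠ-elim a , =ᶠ-elim b))
  ... | inj₂ e = let a , b = ∧-elim {u =ᶠ y} e in inj₂ (inj₂ (=ᶠ-elim a , =ᶠ-elim b))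

  module _ {G′ : Graph n} (G⊑G′ : G ⊑ G′) where

    Cut : Fin n → List (Fin n) → Fin n → Set
    Cut s L e = ∃₂ λ L₁ L₂ → L ≡ L₁ ++ L₂ × ((Pth (adj G′) s L₁ x × Pth (adj G′) y L₂ e)
                                           ⊎ (Pth (adj G′) s L₁ y × Pth (adj G′) x L₂ e))

    Cut-ends : ∀ {s L e} → Cut s L e → x ∈ L × y ∈ L
    Cut-ends (L₁ , L₂ , refl , inj₁ (p , q)) = ∈-++⁺ˡ (Path.Pth-end _ p) , ∈-++⁺ʳ L₁ (Path.Pth-start _ q)
    Cut-ends (L₁ , L₂ , refl , inj₂ (p , q)) = ∈-++⁺ʳ L₁ (Path.Pth-start _ q) , ∈-++⁺ˡ (Path.Pth-end _ p)

    -- A path without repetition passes through the new edge at most once, since one passage uses up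
    -- both `x` and `y`.
    cut : ∀ {s L e} → Pth (adj addEdge) s L e → Unique L → Pth (adj G′) s L e ⊎ Cut s L e
    cut (end s) u = inj₁ (end s)
    cut {s} (r ∷ p) u@(_ ∷ u′) with addEdge-elim r | cut p u′
    ... | inj₁ g | inj₁ q = inj₁ (G⊑G′ g ∷ q)
    ... | inj₂ (inj₁ (refl , refl)) | inj₁ q = inj₂ (s ∷ [] , _ , refl , inj₁ (end s , q))
    ... | inj₂ (inj₂ (refl , refl)) | inj₁ q = inj₂ (s ∷ [] , _ , refl , inj₂ (end s , q))
    ... | inj₁ g | inj₂ (L₁ , L₂ , refl , inj₁ (q₁ , q₂)) = inj₂ (s ∷ L₁ , L₂ , refl , inj₁ (G⊑G′ g ∷ q₁ , q₂))
    ... | inj₁ g | inj₂ (L₁ , L₂ , refl , inj₂ (q₁ , q₂)) = inj₂ (s ∷ L₁ , L₂ , refl , inj₂ (G⊑G′ g ∷ q₁ , q₂))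
    ... | inj₂ (inj₁ (refl , _)) | inj₂ c = contradiction (proj₁ (Cut-ends c)) (Unique-head u)
    ... | inj₂ (inj₂ (refl , _)) | inj₂ c = contradiction (proj₂ (Cut-ends c)) (Unique-head u)

    -- The edge is rejected at the stage `G` of the saturation, while the two paths are wanted in
    -- the final graph `G′`; hence the two graphs.
    Long⇒TwoPaths : ∀ {p} → ¬ Long G′ p → Long addEdge p → TwoPaths G′ p x y
    Long⇒TwoPaths {p} short (L , s , e , path , u , p<) with cut path u
    ... | inj₁ q = contradiction (L , s , e , q , u , p<) short
    ... | inj₂ (L₁ , L₂ , refl , inj₁ (q₁ , q₂)) = let u₁ , u₂ , dj = Unique-++⁻ L₁ u in record
      { pathˣ = Path.rev _ (adj-sym G′) q₁ ; pathʸ = q₂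
      ; uniqueˣ = Unique-reverse L₁ u₁ ; uniqueʸ = u₂ ; disjoint = λ a b → dj (∈-reverse⁻ L₁ a) b
      ; long = subst (p <_) (trans (length-++ L₁) (cong (_+ length L₂) (sym (length-reverse L₁)))) p< }
    ... | inj₂ (L₁ , L₂ , refl , inj₂ (q₁ , q₂)) = let u₁ , u₂ , dj = Unique-++⁻ L₁ u in record
      { pathˣ = q₂ ; pathʸ = Path.rev _ (adj-sym G′) q₁
      ; uniqueˣ = u₂ ; uniqueʸ = Unique-reverse L₁ u₁ ; disjoint = λ a b → dj (∈-reverse⁻ L₁ b) a
      ; long = subst (p <_) (trans (length-++ L₁) (trans (+-comm (length L₁) _) (cong (length L₂ +_) (sym (length-reverse L₁))))) p< }

SaturatedOn : ∀ {n} → List (Fin n × Fin n) → Graph n → ℕ → Set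
SaturatedOn ps G p = ∀ {x y} → (x , y) ∈ ps → x ≢ y → adj G x y ≡ false → TwoPaths G p x y

-- The goal being ⊥, there is no need to decide whether an added edge creates a long path: refuting both answers suffices.
saturate : ∀ {n p} (ps : List (Fin n × Fin n)) (G : Graph n) → ¬ Long G p →
           (∀ G′ → G ⊑ G′ → ¬ Long G′ p → SaturatedOn ps G′ p → ⊥) → ⊥
saturate [] G short κ = κ G id short λ ()
saturate {n} {p} ((x , y) ∷ ps) G short κ with x ≟ y
... | yes refl = saturate ps G short λ G′ le s sat → κ G′ le s
        λ { (here refl) x≢y → contradiction refl x≢y ; (there xy∈) → sat xy∈ }
... | no x≢y = accept reject
  where
  reject : Long (addEdge G x≢y) p → ⊥
  reject long = saturate ps G short λ G′ le s sat → κ G′ le s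
    λ { (here refl) _ _ → Long⇒TwoPaths G x≢y {G′} le s long ; (there xy∈) → sat xy∈ }
  accept : ¬ Long (addEdge G x≢y) p → ⊥
  accept s′ = saturate ps (addEdge G x≢y) s′ λ G′ le s sat → κ G′ (λ {i} {j} e → le {i} {j} (⊑-addEdge G x≢y e)) s
    λ { (here refl) _ e → true≢false (le (addEdge-xy G x≢y)) e ; (there xy∈) → sat xy∈ }

Connected-⊑ : ∀ {n} {G G′ : Graph n} → G ⊑ G′ → Connected G → Connected G′
Connected-⊑ {G = G} {G′} le conn u v = go (conn u v)
  where
  go : ∀ {u v} → Walk G u v → Walk G′ u v
  go here = here
  go (step r w) = step (le r) (go w)

-- Cores, peeling and maximal cliques

Core : ∀ {n} → Graph n → (Fin n → Bool) → ℕ → Set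
Core G A a = ∀ {v} → A v ≡ true → a ≤ countᶠ (λ u → A u ∧ adj G v u)

-- Positions are filled from the last one downwards, each with a vertex that has at most `q`
-- neighbours among the vertices still unplaced, itself included in their number. If none is
-- available while more than `m` remain, these form a core.
peel : ∀ {n} (G : Graph n) q m → m ≤ n →
       (∃ λ ρ → Degenerate G q m ρ) ⊎ (∃ λ A → m < countᶠ A × Core G A (suc q))
peel {n} G q m m≤n = go (n ∸ m) idₚ (≤-reflexive (m∸n+n≡m m≤n))
    λ v h → contradiction (≤-trans (≤-reflexive (sym (m∸n+n≡m m≤n))) h) (<⇒≱ (toℕ<n v))
  where
  go : ∀ d (ρ : Permutation′ n) → d + m ≤ n → (∀ v → d + m ≤ toℕ (ρ ⟨$⟩ʳ v) → BackDegree G ρ v ≤ q) →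
       (∃ λ ρ → Degenerate G q m ρ) ⊎ (∃ λ A → m < countᶠ A × Core G A (suc q))
  go zero ρ le deg = inj₁ (ρ , deg)
  go (suc d) ρ le deg
    with any? (λ v → (toℕ (ρ ⟨$⟩ʳ v) <? suc (d + m)) ×-dec
                     (countᶠ (λ u → (toℕ (ρ ⟨$⟩ʳ u) <ᵇ suc (d + m)) ∧ adj G v u) ≤? q))
  ... | no none = inj₂ ((λ u → toℕ (ρ ⟨$⟩ʳ u) <ᵇ suc (d + m)) , big ,
          λ {v} v∈ → ≰⇒> λ small → none (v , <ᵇ-elim v∈ , small))
    where
    big : m < countᶠ (λ u → toℕ (ρ ⟨$⟩ʳ u) <ᵇ suc (d + m))
    big = ≤-trans (s≤s (m≤n+m m d)) (≤-trans (initial-≤-countᶠ {p = λ i → toℕ i <ᵇ suc (d + m)} le λ i → <ᵇ-intro)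
            (countᶠ-injection (ρ ⟨$⟩ˡ_) (λ _ _ → ⟨$⟩ʳ-injective (flip ρ))
               (subst (λ i → (toℕ i <ᵇ suc (d + m)) ≡ true) (sym (inverseʳ ρ)))))
  ... | yes (v , v< , small) with fin (d + m) le
  ... | w , w≡ = go d (ρ ∘ₚ τ) (<⇒≤ le) deg′
    where
    τ = transpose (ρ ⟨$⟩ʳ v) w
    w< : toℕ w < suc (d + m)
    w< = s≤s (≤-reflexive w≡)
    deg′ : ∀ u → d + m ≤ toℕ (τ ⟨$⟩ʳ (ρ ⟨$⟩ʳ u)) → BackDegree G (ρ ∘ₚ τ) u ≤ q
    deg′ u h = cases (ρ ⟨$⟩ʳ u ≟ ρ ⟨$⟩ʳ v) (ρ ⟨$⟩ʳ u ≟ w)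
      where
      cases : Dec (ρ ⟨$⟩ʳ u ≡ ρ ⟨$⟩ʳ v) → Dec (ρ ⟨$⟩ʳ u ≡ w) → BackDegree G (ρ ∘ₚ τ) u ≤ q
      at-v : u ≡ v → BackDegree G (ρ ∘ₚ τ) u ≤ q
      at-v refl = ≤-trans (countᶠ-mono λ {i} e → let a , b = ∧-elim {adj G v i} e in
        ∧-intro (<ᵇ-intro (transpose-< v< w< (ρ ⟨$⟩ʳ i)
          (m<n⇒m<1+n (<-≤-trans (<ᵇ-elim b) (≤-reflexive (trans (cong toℕ (transpose-left (ρ ⟨$⟩ʳ v) w)) w≡)))))) a) small
      beyond : suc (d + m) ≤ toℕ (ρ ⟨$⟩ʳ u) → τ ⟨$⟩ʳ (ρ ⟨$⟩ʳ u) ≡ ρ ⟨$⟩ʳ u → BackDegree G (ρ ∘ₚ τ) u ≤ q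
      beyond u> fixed = ≤-trans (countᶠ-mono λ {i} e → let a , b = ∧-elim {adj G u i} e in
        ∧-intro a (<ᵇ-intro (transpose-< (<-≤-trans v< u>) (<-≤-trans w< u>) (ρ ⟨$⟩ʳ i)
          (<-≤-trans (<ᵇ-elim b) (≤-reflexive (cong toℕ fixed)))))) (deg u u>)
      cases (yes e) _ = at-v (⟨$⟩ʳ-injective ρ e)
      cases (no ≢v) (no ≢w) = beyond (≤∧≢⇒< (subst (λ i → d + m ≤ toℕ i) fixed h)
          (λ e → ≢w (toℕ-injective (trans (sym e) (sym w≡))))) fixed
        where fixed = transpose-other ≢v ≢w
      -- The vertex displaced by `v` takes the old position of `v`, which is below `d + m`, and is
      -- not yet constrained.
      cases (no ≢v) (yes ≡w) = contradiction (toℕ-injective (trans ρv≡ (sym w≡))) (λ e → ≢v (trans ≡w (sym e)))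
        where
        ρv≡ : toℕ (ρ ⟨$⟩ʳ v) ≡ d + m
        ρv≡ = ≤-antisym (≤-pred v<) (subst (λ i → d + m ≤ toℕ i) (trans (cong (τ ⟨$⟩ʳ_) ≡w) (transpose-right _ w)) h)

Clique : ∀ {n} → Graph n → (Fin n → Bool) → Set
Clique G A = ∀ {u v} → A u ≡ true → A v ≡ true → u ≢ v → adj G u v ≡ true

Clique-Long : ∀ {n} (G : Graph n) {A p} → Clique G A → p < countᶠ A → Long G p
Clique-Long {n} G {A} {p} cl p< with filterᵇ A (allFin n) in eq
... | x ∷ L = x ∷ L , x , let y , path = go x L (subst Unique eq (Unique-filter⁺ _ (Unique-allFin n)))
                                         (λ z∈ → proj₂ (∈-filterᵇ⁻ A (allFin n) (subst (_ ∈_) (sym eq) z∈)))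
                          in y , path , subst Unique eq (Unique-filter⁺ _ (Unique-allFin n)) , p<
  where
  go : ∀ x L → Unique (x ∷ L) → (∀ {z} → z ∈ x ∷ L → A z ≡ true) → ∃ λ y → Pth (adj G) x (x ∷ L) y
  go x [] _ _ = x , end x
  go x (x′ ∷ L) u@(_ ∷ u′) h with go x′ L u′ (h ∘ there)
  ... | y , path = y , cl (h (here refl)) (h (there (here refl))) (λ e → Unique-head u (here e)) ∷ path

-- A member of `A` is blocked by itself through irreflexivity, so maximality can be stated for all
-- vertices alike.
Blocked : ∀ {n} → Graph n → (Fin n → Bool) → Fin n → Set
Blocked G A x = ∃ λ y → A y ≡ true × adj G x y ≡ false

maximal-clique : ∀ {n} (G : Graph n) (L : List (Fin n)) {A} → Clique G A →
                 ∃ λ R → (∀ {v} → A v ≡ true → R v ≡ true) × Clique G R × (∀ {x} → x ∈ L → Blocked G R x)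
maximal-clique G [] {A} cl = A , id , cl , λ ()
maximal-clique G (x ∷ L) {A} cl with any? (λ y → (A y Bool.≟ true) ×-dec (adj G x y Bool.≟ false))
... | yes (y , Ay , xy) with maximal-clique G L cl
... | R , sub , clR , bl = R , sub , clR , λ { (here refl) → y , sub Ay , xy ; (there z∈) → bl z∈ }
maximal-clique G (x ∷ L) {A} cl | no free with maximal-clique G L {λ v → A v ∨ (v =ᶠ x)} cl′
  where
  free′ : ∀ {v} → A v ≡ true → adj G x v ≡ true
  free′ {v} Av with adj G x v in xv
  ... | true  = refl
  ... | false = contradiction (v , Av , xv) free
  cl′ : Clique G (λ v → A v ∨ (v =ᶠ x))
  cl′ {u} {v} hu hv u≢v with ∨-elim {A u} hu | ∨-elim {A v} hv
  ... | inj₁ Au | inj₁ Av = cl Au Av u≢v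
  ... | inj₁ Au | inj₂ e with refl ← =ᶠ-elim e = trans (adj-sym G u v) (free′ Au)
  ... | inj₂ e | inj₁ Av with refl ← =ᶠ-elim e = free′ Av
  ... | inj₂ e | inj₂ e′ = contradiction (trans (=ᶠ-elim e) (sym (=ᶠ-elim e′))) u≢v
... | R , sub , clR , bl = R , (λ Av → sub (cong (_∨ _) Av)) , clR ,
        λ { (here refl) → x , sub (trans (cong (A x ∨_) (=ᶠ-intro refl)) (∨-zeroʳ (A x))) , irrefl G x ; (there z∈) → bl z∈ }

Clique-Core : ∀ {n} (G : Graph n) {A} → Clique G A → Core G A (pred (countᶠ A))
Clique-Core {n} G {A} cl {v} v∈ = pred-mono-≤ {countᶠ A} (≤-trans (≤-reflexive (count-split (allFin n) A (adj G v)))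
  (≤-trans (+-monoʳ-≤ (countᶠ (λ u → A u ∧ adj G v u)) only-v) (≤-reflexive (+-comm _ 1))))
  where
  only-v : countᶠ (λ u → A u ∧ not (adj G v u)) ≤ 1
  only-v = ≤-trans (countᶠ-≤-list {p = λ u → A u ∧ not (adj G v u)} {xs = v ∷ []} λ {u} e → sole u (∧-elim {A u} e)) (count-≤-length (λ u → A u ∧ not (adj G v u)) (v ∷ []))
    where
    sole : ∀ u → A u ≡ true × not (adj G v u) ≡ true → u ∈ v ∷ []
    sole u (Au , nvu) with v ≟ u
    ... | yes refl = here refl
    ... | no v≢u = true≢false (cl v∈ Au v≢u) (not-elim nvu)

outside : ∀ {n} {A B : Fin n → Bool} → countᶠ B < countᶠ A → ∃ λ x → A x ≡ true × B x ≡ false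
outside {A = A} {B} lt with any? (λ x → (A x Bool.≟ true) ×-dec (B x Bool.≟ false))
... | yes h = h
... | no none = contradiction (countᶠ-mono {p = A} {B} inc) (<⇒≱ lt)
  where
  inc : ∀ {x} → A x ≡ true → B x ≡ true
  inc {x} Ax with B x in Bx
  ... | true  = refl
  ... | false = contradiction (x , Ax , Bx) none

-- The choice of q in a saturated graph

module Structure {n} (G : Graph n) {c t k} (conn : Connected G) (short : ¬ Long G (suc c))
                 (sat : Saturated G (suc c)) (p<n : suc c < n) (minDeg : MinDegreeAtLeast G k)
                 (t≤ : t + t ≤ c) (≤t : c ≤ suc (t + t)) where

  open Kopylov G conn short

  everything : Fin n → Bool
  everything _ = true

  2+2t≥p : suc c ≤ suc t + suc t
  2+2t≥p = ≤-trans (s≤s ≤t) (≤-reflexive (cong suc (sym (+-suc t t))))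

  -- `suc t` is the least inner degree whose double reaches `suc c`, the detour order.
  core-clique : ∀ {A} → Core G A (suc t) → Clique G A
  core-clique {A} core Au Av u≢v = adjacent A A core core 2+2t≥p sat Au Av u≢v

  -- Otherwise the whole vertex set would be a core of inner degree above `t`, hence a clique on
  -- more than `suc c` vertices, which contains too long a path.
  k≤t : k ≤ t
  k≤t = ≮⇒≥ λ t<k → short (Clique-Long G {everything} (core-clique λ {v} _ → ≤-trans t<k (minDeg v))
                     (≤-trans p<n (≤-reflexive (sym (countᶠ-true n)))))

  module _ {R} (clR : Clique G R) (bl : ∀ {x} → x ∈ allFin n → Blocked G R x) {q} (q+r : q + countᶠ R ≡ suc c) (0<r : 0 < countᶠ R) where

    -- The inner degrees `suc q` and `pred (countᶠ R)` add up to exactly `suc c`, so `x` would be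
    -- adjacent to all of `R`, against maximality.
    R-absorbs : ∀ A {a} → Core G A a → q < a → ∀ {x} → A x ≡ true → R x ≡ false → ⊥
    R-absorbs A {a} core q<a {x} Ax Rx with bl (∈-allFin x)
    ... | y , Ry , xy = true≢false (adjacent A R core (Clique-Core G clR) p≤ sat Ax Ry (λ { refl → true≢false Ry Rx })) xy
      where
      open ≤-Reasoning
      p≤ : suc c ≤ a + pred (countᶠ R)
      p≤ = begin
        suc c                          ≡⟨ q+r ⟨
        q + countᶠ R                   ≡⟨ cong (q +_) (suc-pred (countᶠ R) {{>-nonZero 0<r}}) ⟨
        q + suc (pred (countᶠ R))      ≡⟨ +-suc q _ ⟩
        suc q + pred (countᶠ R)        ≤⟨ +-monoˡ-≤ _ q<a ⟩
        a + pred (countᶠ R)            ∎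

  -- Phrased as a refutation because saturation is available only for a goal `⊥`.
  degenerate : (∀ q ρ → k ≤ q → q ≤ t → Degenerate G q (c + 1 ∸ q) ρ → ⊥) → ⊥
  degenerate κ with peel G t (c + 1 ∸ t) (≤-trans (m∸n≤m (c + 1) t) (≤-trans (≤-reflexive (+-comm c 1)) (<⇒≤ p<n)))
  ... | inj₁ (ρ , deg) = κ t ρ k≤t ≤-refl deg
  ... | inj₂ (A , big , core) with maximal-clique G (allFin n) (core-clique core)
  ... | R , A⊆R , clR , bl = finish (k ≤? q)
    where
    r = countᶠ R
    r≤ : r ≤ c + 1
    r≤ = ≤-trans (≮⇒≥ (short ∘ Clique-Long G clR)) (≤-reflexive (+-comm 1 c))
    r> : c + 1 ∸ t < r
    r> = <-≤-trans big (countᶠ-mono {p = A} {R} A⊆R)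
    q = c + 1 ∸ r
    q+r : q + r ≡ suc c
    q+r = trans (m∸n+n≡m r≤) (+-comm c 1)
    q≤t : q ≤ t
    q≤t = ≤-trans (∸-monoʳ-≤ (c + 1) (<⇒≤ r>)) (≤-reflexive (m∸[m∸n]≡n
      (≤-trans (m≤m+n t t) (≤-trans t≤ (m≤m+n c 1)))))
    c+1∸q≡r : c + 1 ∸ q ≡ r
    c+1∸q≡r = m∸[m∸n]≡n r≤
    finish : Dec (k ≤ q) → ⊥
    -- With `q < k` the whole vertex set has inner degree above `q`, yet it does not fit into `R`,
    -- which has at most `suc c < n` vertices.
    finish (no k≰q) with outside {A = everything} {R} (≤-<-trans r≤ (≤-trans (≤-reflexive (cong suc (+-comm c 1))) (≤-trans p<n (≤-reflexive (sym (countᶠ-true n))))))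
    ... | x , _ , Rx = R-absorbs clR bl q+r (≤-<-trans z≤n r>) everything (λ {v} _ → minDeg v) (≰⇒> k≰q) {x} refl Rx
    finish (yes k≤q) with peel G q (c + 1 ∸ q) (≤-trans (m∸n≤m (c + 1) q) (≤-trans (≤-reflexive (+-comm c 1)) (<⇒≤ p<n)))
    ... | inj₁ (ρ , deg) = κ q ρ k≤q q≤t deg
    -- `c + 1 ∸ q` is the size of `R`, so a core with more vertices has one outside `R`.
    ... | inj₂ (A′ , big′ , core′) with outside {A = A′} {R} (subst (_< countᶠ A′) c+1∸q≡r big′)
    ... | x , Ax , Rx = R-absorbs clR bl q+r (≤-<-trans z≤n r>) A′ core′ ≤-refl Ax Rx

-- Assembling the bound

half-lower : ∀ c → c / 2 + c / 2 ≤ c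
half-lower c = ≤-trans (≤-reflexive (trans (cong (c / 2 +_) (sym (+-identityʳ _))) (*-comm 2 (c / 2)))) (m/n*n≤m c 2)

half-upper : ∀ c → c ≤ suc (c / 2 + c / 2)
half-upper c = begin
  c                          ≡⟨ m≡m%n+[m/n]*n c 2 ⟩
  c % 2 + c / 2 * 2          ≤⟨ +-monoˡ-≤ _ (≤-pred (m%n<n c 2)) ⟩
  suc (c / 2 * 2)            ≡⟨ cong suc (trans (*-comm (c / 2) 2) (cong (c / 2 +_) (+-identityʳ _))) ⟩
  suc (c / 2 + c / 2)        ∎
  where open ≤-Reasoning

detour<order : ∀ {n p} {G : Graph n} → Nontraceable G → DetourOrder G p → p < n
detour<order {n} {G = G} nt ((P , (u , l) , refl) , _) = ≰⇒> λ n≤p → nt (P , (u , l) , λ v → covers n≤p v)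
  where
  covers : n ≤ length P → ∀ v → v ∈ P
  covers n≤p v with DecMembership._∈?_ _≟_ v P
  ... | yes v∈ = v∈
  ... | no v∉ = contradiction (≤-trans (Unique-length-≤ (∉⇒All≢ v∉ ∷ u) (λ _ → ∈-allFin _)) (≤-trans (≤-reflexive (length-tabulate id)) n≤p)) 1+n≰n

theorem2 : (rs : List ℕ) → All (λ r → 1 ≤ r) rs →
    (n p k : ℕ) (G : Graph n) →
    Connected G → Nontraceable G → DetourOrder G p → MinDegreeAtLeast G k →
    N (K rs) G ≤ (g rs n (p ∸ 1) k ⊔ g rs n (p ∸ 1) ((p ∸ 1) / 2))
-- Detour order 0 is impossible: it is less than `n`, so a vertex exists, and by itself it is a
-- path.
theorem2 rs _ n zero k G conn nt det minDeg with fin {n} 0 (detour<order {G = G} nt det)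
... | v , _ = contradiction (proj₂ det (v ∷ []) ([] ∷ [] , Path.Pth⇒Linked (adj G) (end v))) λ ()
-- The bound is a decidable inequality, so it is enough to refute its negation; this turns the goal
-- into the `⊥` that saturation requires.
theorem2 rs _ n (suc c) k G conn nt det minDeg = decidable-stable (_ ≤? _) λ ¬bound →
  saturate (cartesianProduct (allFin n) (allFin n)) G short λ G′ G⊑G′ short′ sat →
  Structure.degenerate G′ (Connected-⊑ {G = G} {G′} G⊑G′ conn) short′
    (λ x y → sat (∈-cartesianProduct⁺ (∈-allFin x) (∈-allFin y))) p<n
    (λ v → ≤-trans (minDeg v) (countᶠ-mono {p = adj G v} {adj G′ v} G⊑G′)) (half-lower c) (half-upper c)
    λ q ρ k≤q q≤t deg → ¬bound (begin
      N H G                     ≤⟨ N-mono H {G} {G′} G⊑G′ ⟩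
      N H G′                    ≤⟨ N-degenerate H (K-cotransitive rs) G′ (q≤ q≤t) ρ deg ⟩
      N H (Gnck n c q)          ≤⟨ convex⇒≤ends (λ q → N H (Gnck n c q)) k (c / 2) convex q k≤q q≤t ⟩
      g rs n c k ⊔ g rs n c (c / 2) ∎)
  where
  open ≤-Reasoning
  H = K rs
  p<n : suc c < n
  p<n = detour<order {G = G} nt det
  short : ¬ Long G (suc c)
  short (L , x , y , path , u , p<) = <⇒≱ p< (proj₂ det L (u , Path.Pth⇒Linked (adj G) path))
  q≤ : ∀ {q} → q ≤ c / 2 → q ≤ c + 1 ∸ q
  q≤ {q} h = m+n≤o⇒m≤o∸n q (≤-trans (+-mono-≤ h h) (≤-trans (half-lower c) (m≤m+n c 1)))
  convex : ∀ q → k ≤ q → 2 + q ≤ c / 2 → N H (Gnck n c (1 + q)) + N H (Gnck n c (1 + q)) ≤ N H (Gnck n c q) + N H (Gnck n c (2 + q))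
  convex q _ h = Convexity.N-convex H (K-cotransitive rs) (<-trans (n<1+n c) p<n) q
    (≤-trans (≤-reflexive eq) (≤-trans (+-mono-≤ h h) (half-lower c)))
    where
    eq : q + q + 4 ≡ (2 + q) + (2 + q)
    eq = trans (+-comm (q + q) 4) (cong (2 +_) (trans (sym (+-suc (suc q) q)) (sym (+-suc q (suc q)))))
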